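{- Let $\alpha$ be an irrational number with simple continued fraction expansion $\alpha=[b_0;b_1,b_2,\ldots]$. If the partial quotients satisfy the growth restriction $b_n=e^{o(n)}$ as $n\to\infty$ (for example, $b_n$ bounded, or a polynomial in $n$, or $b_n<e^{n/\ln n}$), then $\mu(\alpha)=2$. If $b_n=e^{o(F_n)}$ as $n\to\infty$ (for instance, $b_n<e^{(3/2)^n}$), where $F_n$ is the $n$-th Fibonacci number, then $\beta(\alpha)=1$.
   Context: Irrationality exponent: for a real irrational number $\alpha$, $\mu(\alpha)$ is the least real $\mu>0$ such that for every $\varepsilon>0$ there is a positive integer $q(\varepsilon)$ with $\left|\alpha-\frac pq\right|>q^{ -(\mu+\varepsilon)}$ for all integers $p,q$ with $q\ge q(\varepsilon)$; if no such $\mu$ exists, $\mu(\alpha)=\infty$. Irrationality base: $\beta(\alpha)$ is the least real $\beta\ge 1$ such that for every $\varepsilon>0$ there is a positive integer $q(\varepsilon)$ with $\left|\alpha-\frac pq\right|>\frac{1}{(\beta+\varepsilon)^q}$ for all integers $p,q$ with $q\ge q(\varepsilon)$; if no such $\beta$ exists, $\beta(\alpha)=\infty$. Conventions: $b_0$ is an integer, $b_1,b_2,\ldots$ are positive integers, and $[b_0;b_1,b_2,\ldots]=b_0+\cfrac{1}{b_1+\cfrac{1}{b_2+\cdots}}$. The condition $b_n=e^{o(g(n))}$ means $\ln b_n/g(n)\to0$ as $n\to\infty$ (a condition on the $b_n$ with $n\ge1$). The Fibonacci numbers are indexed by $F_1=1$, $F_2=2$, $F_{n+1}=F_n+F_{n-1}$.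 -}

module Defs where

open import Algebra.Definitions.RawSemiring using () renaming (_^_ to pow)
open import Data.Integer.Base as ℤ using (ℤ; +_; -[1+_])
open import Data.Nat.Base as ℕ using (ℕ; zero; suc; _!)
open import Data.Nat.Properties using (_!≢0)
open import Data.Product using (Σ-syntax; ∃-syntax; _×_)
open import Data.Rational.Base as ℚ using (ℚ; 0ℚ; 1ℚ; ↥_; ↧ₙ_)
open import Data.Rational.Properties using (normalize-pos; pos⇒nonZero; pos+pos⇒pos; 1/pos⇒pos)
open import Data.Sum using (_⊎_)
open import Relation.Binary.PropositionalEquality.Core using (_≡_)
open import Relation.Nullary using (¬_)

------------------------------------------------------------------------
-- Real numbers as two-sided Dedekind cuts of ℚ.
--
-- The operations below are defined on bare pairs of sets of rationals
-- (`lower x r` is r < x, `upper x r` is x < r); `IsReal` picks out the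
-- real numbers among these pairs.  On the domains stated with them, the
-- operations denote the usual operations on real numbers.  No proof that
-- they preserve `IsReal` is needed in order to state results, so every
-- quantifier over reals carries `IsReal` explicitly.

record Cut : Set₁ where
  constructor cut
  field
    lower : ℚ → Set
    upper : ℚ → Set

open Cut public

record IsReal (x : Cut) : Set where
  field
    lower-inhabited : ∃[ r ] lower x r
    upper-inhabited : ∃[ r ] upper x r
    lower-closed    : ∀ {r s} → r ℚ.< s → lower x s → lower x r
    upper-closed    : ∀ {r s} → r ℚ.< s → upper x r → upper x s
    lower-open      : ∀ {r} → lower x r → ∃[ s ] r ℚ.< s × lower x s
    upper-open      : ∀ {s} → upper x s → ∃[ r ] r ℚ.< s × upper x r
    disjoint        : ∀ {r} → ¬ (lower x r × upper x r)
    located         : ∀ {r s} → r ℚ.< s → lower x r ⊎ upper x s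

infix 4 _<_ _≤_ _≃_

_<_ : Cut → Cut → Set
x < y = ∃[ r ] upper x r × lower y r

_≤_ : Cut → Cut → Set
x ≤ y = ¬ (y < x)

_≃_ : Cut → Cut → Set
x ≃ y = x ≤ y × y ≤ x

fromℚ : ℚ → Cut
fromℚ p = cut (λ r → r ℚ.< p) (λ r → p ℚ.< r)

fromℤ : ℤ → Cut
fromℤ i = fromℚ (i ℚ./ 1)

fromℕ : ℕ → Cut
fromℕ n = fromℤ (+ n)

infixl 6 _+_ _-_
infixl 7 _*_ _÷_
infix  8 -_
infixr 9 _^_

_+_ : Cut → Cut → Cut
x + y = cut
  (λ r → ∃[ s ] ∃[ t ] lower x s × lower y t × s ℚ.+ t ≡ r)
  (λ r → ∃[ s ] ∃[ t ] upper x s × upper y t × s ℚ.+ t ≡ r)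

-_ : Cut → Cut
- x = cut (λ r → upper x (ℚ.- r)) (λ r → lower x (ℚ.- r))

_-_ : Cut → Cut → Cut
x - y = x + (- y)

-- ∣ x ∣ = max (x , - x)
∣_∣ : Cut → Cut
∣ x ∣ = cut
  (λ r → lower x r ⊎ lower (- x) r)
  (λ r → upper x r × upper (- x) r)

-- P holds at the four corners of some rational box [a,b] × [c,d] whose
-- interior contains (x , y).  A function monotone in each variable
-- separately attains its extrema over a box at the corners.
AtCorners : (ℚ → ℚ → Set) → Cut → Cut → Set
AtCorners P x y =
  ∃[ a ] ∃[ b ] ∃[ c ] ∃[ d ]
    (lower x a × upper x b × lower y c × upper y d) ×
    (P a c × P a d × P b c × P b d)

_*_ : Cut → Cut → Cut
x * y = cut
  (λ r → AtCorners (λ a c → r ℚ.< a ℚ.* c) x y)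
  (λ r → AtCorners (λ a c → a ℚ.* c ℚ.< r) x y)

-- for x > 0
recip : Cut → Cut
recip x = cut
  (λ r → ∃[ u ] upper x u × r ℚ.* u ℚ.< 1ℚ)
  (λ r → ∃[ l ] 0ℚ ℚ.< l × lower x l × 1ℚ ℚ.< r ℚ.* l)

-- for y > 0
_÷_ : Cut → Cut → Cut
x ÷ y = x * recip y

------------------------------------------------------------------------
-- Real powers, e and the natural logarithm

infixr 9 _^ℚ_

_^ℚ_ : ℚ → ℕ → ℚ
_^ℚ_ = pow ℚ.+-*-rawSemiring

_⁺ _⁻ : ℤ → ℕ
(+ n)      ⁺ = n
(-[1+ n ]) ⁺ = 0
(+ n)      ⁻ = 0
(-[1+ n ]) ⁻ = suc n

-- For rational a > 0 and s = c / d: the relations r < aˢ and aˢ < r,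
-- i.e. (for r > 0) rᵈ < aᶜ and aᶜ < rᵈ.  A negative power of a is moved
-- to the other side of the inequality.
BelowPow : ℚ → ℚ → ℚ → Set
BelowPow r a s =
  0ℚ ℚ.< a ×
  (r ℚ.≤ 0ℚ ⊎ r ^ℚ (↧ₙ s) ℚ.* a ^ℚ ((↥ s) ⁻) ℚ.< a ^ℚ ((↥ s) ⁺))

AbovePow : ℚ → ℚ → ℚ → Set
AbovePow r a s =
  0ℚ ℚ.< a ×
  (0ℚ ℚ.< r × a ^ℚ ((↥ s) ⁺) ℚ.< r ^ℚ (↧ₙ s) ℚ.* a ^ℚ ((↥ s) ⁻))

-- for x > 0 and arbitrary real y
_^_ : Cut → Cut → Cut
x ^ y = cut
  (λ r → AtCorners (BelowPow r) x y)
  (λ r → AtCorners (AbovePow r) x y)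

-- 1/0! + 1/1! + ⋯ + 1/n!
expSum : ℕ → ℚ
expSum zero    = 1ℚ
expSum (suc n) = expSum n ℚ.+ ((+ 1) ℚ./ (suc n !)) {{suc n !≢0}}

-- the supremum of the increasing sequence expSum
e : Cut
e = cut
  (λ r → ∃[ n ] r ℚ.< expSum n)
  (λ r → ∃[ s ] s ℚ.< r × (∀ n → expSum n ℚ.≤ s))

-- for x > 0
ln : Cut → Cut
ln x = cut (λ r → e ^ fromℚ r < x) (λ r → x < e ^ fromℚ r)

------------------------------------------------------------------------
-- Limits, continued fractions and growth conditions

infix 4 _⟶_

_⟶_ : (ℕ → Cut) → Cut → Set₁
x ⟶ l = ∀ (ε : Cut) → IsReal ε → fromℕ 0 < ε →
  ∃[ N ] (∀ n → N ℕ.≤ n → ∣ x n - l ∣ < ε)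

Irrational : Cut → Set
Irrational α = ∀ (r : ℚ) → ¬ (α ≃ fromℚ r)

module _ (b : ℕ → ℤ) (b-pos : ∀ n → ℤ.Positive (b (suc n))) where

  private
    /1-pos : ∀ i → ℤ.Positive i → ℚ.Positive (i ℚ./ 1)
    /1-pos (+ suc n) _ = normalize-pos (suc n) 1

  mutual
    -- [ b (k+1) ; b (k+2) , … , b (k+1+n) ]
    tail : ℕ → ℕ → ℚ
    tail k zero    = b (suc k) ℚ./ 1
    tail k (suc n) =
      b (suc k) ℚ./ 1 ℚ.+
      (ℚ.1/ tail (suc k) n) {{pos⇒nonZero (tail (suc k) n) {{tail-pos (suc k) n}}}}

    tail-pos : ∀ k n → ℚ.Positive (tail k n)
    tail-pos k zero    = /1-pos (b (suc k)) (b-pos k)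
    tail-pos k (suc n) =
      pos+pos⇒pos (b (suc k) ℚ./ 1) {{/1-pos (b (suc k)) (b-pos k)}} _
        {{1/pos⇒pos (tail (suc k) n) {{tail-pos (suc k) n}}}}

  -- [ b 0 ; b 1 , … , b n ]
  convergent : ℕ → ℚ
  convergent zero    = b 0 ℚ./ 1
  convergent (suc n) =
    b 0 ℚ./ 1 ℚ.+ (ℚ.1/ tail 0 n) {{pos⇒nonZero (tail 0 n) {{tail-pos 0 n}}}}

  -- α = [ b 0 ; b 1 , b 2 , … ]
  IsContinuedFractionOf : Cut → Set₁
  IsContinuedFractionOf α = (λ n → fromℚ (convergent n)) ⟶ α

-- b n = e^{o(g n)}, i.e. ln (b n) / g n ⟶ 0, the sequence being taken over
-- n ≥ 1; b n and g n are assumed positive there.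
_=e^o_ : (ℕ → ℤ) → (ℕ → ℕ) → Set₁
b =e^o g = (λ n → ln (fromℤ (b (suc n))) ÷ fromℕ (g (suc n))) ⟶ fromℕ 0

-- indexed so that fib 1 = 1 and fib 2 = 2
fib : ℕ → ℕ
fib 0             = 1
fib 1             = 1
fib (suc (suc n)) = fib (suc n) ℕ.+ fib n

------------------------------------------------------------------------
-- Irrationality exponent and irrationality base

data Extended : Set₁ where
  finite : Cut → Extended
  ∞      : Extended

-- `IsLeast P m`: m is the least real satisfying P, or ∞ if there is none.
IsLeast : (Cut → Set₁) → Extended → Set₁
IsLeast P (finite x) = (IsReal x × P x) × (∀ y → IsReal y → P y → x ≤ y)
IsLeast P ∞          = ¬ (Σ[ x ∈ Cut ] IsLeast P (finite x))

ExponentBound : Cut → Cut → Set₁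
ExponentBound α μ = fromℕ 0 < μ ×
  (∀ (ε : Cut) → IsReal ε → fromℕ 0 < ε →
    ∃[ Q ] 1 ℕ.≤ Q ×
      (∀ (p : ℤ) (q : ℕ) .{{_ : ℕ.NonZero q}} → Q ℕ.≤ q →
        fromℕ q ^ (- (μ + ε)) < ∣ α - fromℚ (p ℚ./ q) ∣))

BaseBound : Cut → Cut → Set₁
BaseBound α β = fromℕ 1 ≤ β ×
  (∀ (ε : Cut) → IsReal ε → fromℕ 0 < ε →
    ∃[ Q ] 1 ℕ.≤ Q ×
      (∀ (p : ℤ) (q : ℕ) .{{_ : ℕ.NonZero q}} → Q ℕ.≤ q →
        recip ((β + ε) ^ fromℕ q) < ∣ α - fromℚ (p ℚ./ q) ∣))

-- μ(α) = m
IrrationalityExponent : Cut → Extended → Set₁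
IrrationalityExponent α = IsLeast (ExponentBound α)

-- β(α) = m
IrrationalityBase : Cut → Extended → Set₁
IrrationalityBase α = IsLeast (BaseBound α)

-- Let x = [b₀; …, bₖ, t] with t ≥ 1 and convergents pₖ / qₖ.  If 0 < q < qₖ then, for every p,
-- u = q pₖ - p qₖ and v = q pₖ₋₁ - p qₖ₋₁ satisfy |qₖ₋₁ u - qₖ v| = q < qₖ, so u ≠ 0 and v does not
-- have the opposite sign; since (q x - p) (qₖ t + qₖ₋₁) = u t + v, this gives |q x - p| ≥ 1 / 2qₖ.
-- Choosing n with qₙ ≤ q < qₙ₊₁ ≤ 2 bₙ₊₁ q, every p / q is at distance at least 1 / (4 bₙ₊₁ q²) from
-- all late convergents, hence at least 1 / (8 bₙ₊₁ q²) from α.  As qₙ ≥ Fₙ ≥ c 2^(n/2), the growth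
-- conditions bound bₙ₊₁ by q^ε, respectively by (1 + ε)^q.  Conversely |α - pₙ / qₙ| ≤ 1 / qₙ² shows
-- that the exponent is at least 2.

module Submission where

open import Algebra.Bundles using (module CommutativeRing)
import Algebra.Properties.CommutativeSemiring.Exp
open import Data.Integer.Base as ℤ using (ℤ; +_; -[1+_]; Positive)
import Data.Integer.Properties as ℤ
import Data.Integer.Solver
open import Data.Nat.Base as ℕ using (ℕ; zero; suc; _!)
import Data.Nat.DivMod as ℕ
import Data.Nat.Properties as ℕ
import Data.Nat.Solver
open import Data.Product using (∃-syntax; _×_; _,_; proj₁; proj₂)
open import Data.Rational.Base as ℚ using (ℚ; 0ℚ; 1ℚ; ½; mkℚ; ↥_; ↧ₙ_)
import Data.Rational.Properties as ℚ
open import Data.Rational.Solver using (module +-*-Solver)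
import Data.Rational.Unnormalised.Base as ℚᵘ
import Data.Rational.Unnormalised.Properties as ℚᵘ
open import Data.Sum using (_⊎_; inj₁; inj₂)
open import Defs
open import Relation.Binary.Definitions using (tri<; tri≈; tri>)
open import Relation.Binary.PropositionalEquality
open import Relation.Nullary using (¬_; contradiction; yes; no)

open Algebra.Properties.CommutativeSemiring.Exp
  (CommutativeRing.commutativeSemiring ℚ.+-*-commutativeRing)
  using (^-assocʳ; ^-distrib-*)
open +-*-Solver using (solve; con; _:=_; _:+_; _:-_; _:*_; :-_)
module ℕS = Data.Nat.Solver.+-*-Solver
module ℤS = Data.Integer.Solver.+-*-Solver

-- Rational arithmetic

-- Real numbers enter only as cuts: a strict inequality is proved by exhibiting a rational strictly
-- in between, and an assumed one is used by unpacking the rationals it carries. For both upper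
-- bounds this rational is 1/M with M = 8 bₙ₊₁ q², after which only an inequality between natural
-- numbers remains. A power is witnessed on a box with the point strictly inside, so a base or
-- exponent q appears as the interval [q - 1, q + 1]; this is why the numerical estimates are about
-- q - 1 and q - 2. Of e only the bounds 1 and 3 are used: for each fixed K the growth hypothesis
-- becomes bₙ^K < 3^g(n) for all large n. The complete quotient of α never occurs. The number t is
-- the finite, rational tail of a later convergent, the bounds do not depend on its length, and α is
-- reached from a convergent within a small δ. Paying for this δ is what turns the constant 4 into
-- 8.

ι : ℤ → ℚ
ι i = i ℚ./ 1

ιℕ : ℕ → ℚ
ιℕ n = ι (+ n)

private
  toℚᵘ-/ : ∀ p q .{{_ : ℕ.NonZero q}} → ℚ.toℚᵘ (p ℚ./ q) ℚᵘ.≃ (p ℚᵘ./ q)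
  toℚᵘ-/ p (suc d) = ℚ.toℚᵘ-fromℚᵘ (ℚᵘ.mkℚᵘ p d)

ι-+ : ∀ i j → ι (i ℤ.+ j) ≡ ι i ℚ.+ ι j
ι-+ i j = ℚ.toℚᵘ-injective (ℚᵘ.≃-trans (toℚᵘ-/ (i ℤ.+ j) 1) (ℚᵘ.≃-sym (ℚᵘ.≃-trans
  (ℚ.toℚᵘ-homo-+ (ι i) (ι j)) (ℚᵘ.≃-trans (ℚᵘ.+-cong (toℚᵘ-/ i 1) (toℚᵘ-/ j 1))
  (ℚᵘ.*≡* (cong (ℤ._* + 1) (cong₂ ℤ._+_ (ℤ.*-identityʳ i) (ℤ.*-identityʳ j))))))))

ι-* : ∀ i j → ι (i ℤ.* j) ≡ ι i ℚ.* ι j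
ι-* i j = ℚ.toℚᵘ-injective (ℚᵘ.≃-trans (toℚᵘ-/ (i ℤ.* j) 1) (ℚᵘ.≃-sym (ℚᵘ.≃-trans
  (ℚ.toℚᵘ-homo-* (ι i) (ι j)) (ℚᵘ.≃-trans (ℚᵘ.*-cong (toℚᵘ-/ i 1) (toℚᵘ-/ j 1))
  (ℚᵘ.*≡* refl)))))

ι-neg : ∀ i → ι (ℤ.- i) ≡ ℚ.- ι i
ι-neg i = ℚ.toℚᵘ-injective (ℚᵘ.≃-trans (toℚᵘ-/ (ℤ.- i) 1) (ℚᵘ.≃-sym (ℚᵘ.≃-trans
  (ℚ.toℚᵘ-homo‿- (ι i)) (ℚᵘ.≃-trans (ℚᵘ.-‿cong (toℚᵘ-/ i 1)) (ℚᵘ.*≡* refl)))))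

ι-mono-≤ : ∀ {i j} → i ℤ.≤ j → ι i ℚ.≤ ι j
ι-mono-≤ {i} {j} i≤j = ℚ.toℚᵘ-cancel-≤ (ℚᵘ.≤-respˡ-≃ (ℚᵘ.≃-sym (toℚᵘ-/ i 1))
  (ℚᵘ.≤-respʳ-≃ (ℚᵘ.≃-sym (toℚᵘ-/ j 1)) (ℚᵘ.*≤* (ℤ.*-monoʳ-≤-nonNeg (+ 1) i≤j))))

ι-mono-< : ∀ {i j} → i ℤ.< j → ι i ℚ.< ι j
ι-mono-< {i} {j} i<j = ℚ.toℚᵘ-cancel-< (ℚᵘ.<-respˡ-≃ (ℚᵘ.≃-sym (toℚᵘ-/ i 1))
  (ℚᵘ.<-respʳ-≃ (ℚᵘ.≃-sym (toℚᵘ-/ j 1)) (ℚᵘ.*<* (ℤ.*-monoʳ-<-pos (+ 1) i<j))))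

ι-cancel-< : ∀ {i j} → ι i ℚ.< ι j → i ℤ.< j
ι-cancel-< {i} {j} lt with i ℤ.<? j
... | yes p = p
... | no ¬p = contradiction (ι-mono-≤ (ℤ.≮⇒≥ ¬p)) (λ le → ℚ.<-irrefl refl (ℚ.<-≤-trans lt le))

/-*-cancel : ∀ p q .{{_ : ℕ.NonZero q}} → (p ℚ./ q) ℚ.* ιℕ q ≡ ι p
/-*-cancel p q@(suc d) = ℚ.toℚᵘ-injective (ℚᵘ.≃-trans (ℚ.toℚᵘ-homo-* (p ℚ./ q) (ιℕ q))
  (ℚᵘ.≃-trans (ℚᵘ.*-cong (toℚᵘ-/ p q) (toℚᵘ-/ (+ q) 1))
    (ℚᵘ.≃-trans (ℚᵘ.*≡* lem) (ℚᵘ.≃-sym (toℚᵘ-/ p 1)))))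
  where
  lem : p ℤ.* + q ℤ.* + 1 ≡ p ℤ.* (+ suc (ℕ.pred (suc d ℕ.* 1)))
  lem = trans (ℤ.*-identityʳ _) (cong (λ z → p ℤ.* + z) (sym (ℕ.*-identityʳ q)))

x≡↥/↧ : ∀ x → x ℚ.* ιℕ (ℚ.↧ₙ x) ≡ ι (ℚ.↥ x)
x≡↥/↧ x = trans (cong (ℚ._* ιℕ (ℚ.↧ₙ x)) (sym (ℚ.↥p/↧p≡p x))) (/-*-cancel (ℚ.↥ x) (ℚ.↧ₙ x))

ιℕ-mono-≤ : ∀ {m n} → m ℕ.≤ n → ιℕ m ℚ.≤ ιℕ n
ιℕ-mono-≤ m≤n = ι-mono-≤ (ℤ.+≤+ m≤n)

ιℕ-mono-< : ∀ {m n} → m ℕ.< n → ιℕ m ℚ.< ιℕ n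
ιℕ-mono-< m<n = ι-mono-< (ℤ.+<+ m<n)

ιℕ-cancel-< : ∀ {m n} → ιℕ m ℚ.< ιℕ n → m ℕ.< n
ιℕ-cancel-< lt = ℤ.drop‿+<+ (ι-cancel-< lt)

ιℕ-+ : ∀ m n → ιℕ (m ℕ.+ n) ≡ ιℕ m ℚ.+ ιℕ n
ιℕ-+ m n = ι-+ (+ m) (+ n)

ιℕ-* : ∀ m n → ιℕ (m ℕ.* n) ≡ ιℕ m ℚ.* ιℕ n
ιℕ-* m n = trans (cong ι (ℤ.pos-* m n)) (ι-* (+ m) (+ n))

ιℕ-^ : ∀ m n → ιℕ (m ℕ.^ n) ≡ ιℕ m ^ℚ n
ιℕ-^ m zero    = refl
ιℕ-^ m (suc n) = trans (ιℕ-* m (m ℕ.^ n)) (cong (ιℕ m ℚ.*_) (ιℕ-^ m n))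

0≤ιℕ : ∀ n → 0ℚ ℚ.≤ ιℕ n
0≤ιℕ n = ιℕ-mono-≤ {0} {n} ℕ.z≤n

0<1 : 0ℚ ℚ.< 1ℚ
0<1 = ιℕ-mono-< {0} {1} (ℕ.s≤s ℕ.z≤n)

<⇒0<- : ∀ {x y} → x ℚ.< y → 0ℚ ℚ.< y ℚ.- x
<⇒0<- {x} {y} x<y = subst (ℚ._< y ℚ.- x) (ℚ.+-inverseʳ x) (ℚ.+-monoˡ-< (ℚ.- x) x<y)

0<-⇒< : ∀ {x y} → 0ℚ ℚ.< y ℚ.- x → x ℚ.< y
0<-⇒< {x} {y} p = subst₂ ℚ._<_ (ℚ.+-identityˡ x) (solve 2 (λ x y → (y :- x) :+ x := y) refl x y)
  (ℚ.+-monoˡ-< x p)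

0≤-⇒≤ : ∀ {x y} → 0ℚ ℚ.≤ y ℚ.- x → x ℚ.≤ y
0≤-⇒≤ {x} {y} p = subst₂ ℚ._≤_ (ℚ.+-identityˡ x) (solve 2 (λ x y → (y :- x) :+ x := y) refl x y)
  (ℚ.+-monoˡ-≤ x p)

*-mono-≤ : ∀ {x y u v} → 0ℚ ℚ.≤ u → 0ℚ ℚ.≤ y → x ℚ.≤ y → u ℚ.≤ v → x ℚ.* u ℚ.≤ y ℚ.* v
*-mono-≤ {x} {y} {u} {v} 0≤u 0≤y x≤y u≤v = ℚ.≤-trans
  (ℚ.*-monoʳ-≤-nonNeg u {{ℚ.nonNegative 0≤u}} x≤y) (ℚ.*-monoˡ-≤-nonNeg y {{ℚ.nonNegative 0≤y}} u≤v)

*-monoʳ-< : ∀ {x u v} → 0ℚ ℚ.< x → u ℚ.< v → x ℚ.* u ℚ.< x ℚ.* v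
*-monoʳ-< {x} 0<x = ℚ.*-monoʳ-<-pos x {{ℚ.positive 0<x}}

*-monoˡ-< : ∀ {x u v} → 0ℚ ℚ.< x → u ℚ.< v → u ℚ.* x ℚ.< v ℚ.* x
*-monoˡ-< {x} 0<x = ℚ.*-monoˡ-<-pos x {{ℚ.positive 0<x}}

*-monoʳ-≤ : ∀ {x u v} → 0ℚ ℚ.≤ x → u ℚ.≤ v → x ℚ.* u ℚ.≤ x ℚ.* v
*-monoʳ-≤ {x} 0≤x = ℚ.*-monoˡ-≤-nonNeg x {{ℚ.nonNegative 0≤x}}

*-monoˡ-≤ : ∀ {x u v} → 0ℚ ℚ.≤ x → u ℚ.≤ v → u ℚ.* x ℚ.≤ v ℚ.* x
*-monoˡ-≤ {x} 0≤x = ℚ.*-monoʳ-≤-nonNeg x {{ℚ.nonNegative 0≤x}}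

0<* : ∀ {x y} → 0ℚ ℚ.< x → 0ℚ ℚ.< y → 0ℚ ℚ.< x ℚ.* y
0<* {x} {y} 0<x 0<y = subst (ℚ._< x ℚ.* y) (ℚ.*-zeroʳ x) (*-monoʳ-< 0<x 0<y)

0≤* : ∀ {x y} → 0ℚ ℚ.≤ x → 0ℚ ℚ.≤ y → 0ℚ ℚ.≤ x ℚ.* y
0≤* {x} {y} 0≤x 0≤y = subst (ℚ._≤ x ℚ.* y) (ℚ.*-zeroʳ x) (*-monoʳ-≤ 0≤x 0≤y)

*-cancelʳ-< : ∀ {x u v} → 0ℚ ℚ.≤ x → u ℚ.* x ℚ.< v ℚ.* x → u ℚ.< v
*-cancelʳ-< {x} 0≤x = ℚ.*-cancelʳ-<-nonNeg x {{ℚ.nonNegative 0≤x}}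

*-cancelʳ-≤ : ∀ {x u v} → 0ℚ ℚ.< x → u ℚ.* x ℚ.≤ v ℚ.* x → u ℚ.≤ v
*-cancelʳ-≤ {x} 0<x = ℚ.*-cancelʳ-≤-pos x {{ℚ.positive 0<x}}

0≤^ : ∀ {x} n → 0ℚ ℚ.≤ x → 0ℚ ℚ.≤ x ^ℚ n
0≤^ zero    0≤x = ℚ.<⇒≤ 0<1
0≤^ (suc n) 0≤x = 0≤* 0≤x (0≤^ n 0≤x)

0<^ : ∀ {x} n → 0ℚ ℚ.< x → 0ℚ ℚ.< x ^ℚ n
0<^ zero    0<x = 0<1
0<^ (suc n) 0<x = 0<* 0<x (0<^ n 0<x)

^-monoˡ-≤ : ∀ {x y} n → 0ℚ ℚ.≤ x → x ℚ.≤ y → x ^ℚ n ℚ.≤ y ^ℚ n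
^-monoˡ-≤ zero    0≤x x≤y = ℚ.≤-refl
^-monoˡ-≤ (suc n) 0≤x x≤y = *-mono-≤ (0≤^ n 0≤x) (ℚ.≤-trans 0≤x x≤y) x≤y (^-monoˡ-≤ n 0≤x x≤y)

1^ : ∀ n → 1ℚ ^ℚ n ≡ 1ℚ
1^ zero    = refl
1^ (suc n) = trans (ℚ.*-identityˡ _) (1^ n)

1≤^ : ∀ {x} n → 1ℚ ℚ.≤ x → 1ℚ ℚ.≤ x ^ℚ n
1≤^ {x} n 1≤x = subst (ℚ._≤ x ^ℚ n) (1^ n) (^-monoˡ-≤ n (ℚ.<⇒≤ 0<1) 1≤x)

^-monoʳ-≤ : ∀ {x m n} → 1ℚ ℚ.≤ x → m ℕ.≤ n → x ^ℚ m ℚ.≤ x ^ℚ n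
^-monoʳ-≤ {x} {n = n} 1≤x ℕ.z≤n = 1≤^ n 1≤x
^-monoʳ-≤ 1≤x (ℕ.s≤s m≤n) = *-monoʳ-≤ (ℚ.≤-trans (ℚ.<⇒≤ 0<1) 1≤x) (^-monoʳ-≤ 1≤x m≤n)

^-monoʳ-< : ∀ {x m n} → 1ℚ ℚ.< x → m ℕ.< n → x ^ℚ m ℚ.< x ^ℚ n
^-monoʳ-< {x} {m} {n} 1<x m<n = ℚ.<-≤-trans
  (subst (ℚ._< x ^ℚ suc m) (ℚ.*-identityˡ _) (*-monoˡ-< (0<^ m (ℚ.<-trans 0<1 1<x)) 1<x))
  (^-monoʳ-≤ (ℚ.<⇒≤ 1<x) m<n)

bernoulli : ∀ {h} n → 0ℚ ℚ.≤ h → 1ℚ ℚ.+ ιℕ n ℚ.* h ℚ.≤ (1ℚ ℚ.+ h) ^ℚ n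
bernoulli {h} zero    0≤h = ℚ.≤-reflexive (trans (cong (1ℚ ℚ.+_) (ℚ.*-zeroˡ h)) (ℚ.+-identityʳ 1ℚ))
bernoulli {h} (suc n) 0≤h = ℚ.≤-trans (0≤-⇒≤ (subst (0ℚ ℚ.≤_) eq (0≤* (0≤ιℕ n) (0≤* 0≤h 0≤h))))
  (*-monoʳ-≤ (ℚ.≤-trans 0≤h (ℚ.≤-trans (ℚ.≤-reflexive (sym (ℚ.+-identityˡ h)))
    (ℚ.+-monoˡ-≤ h (ℚ.<⇒≤ 0<1)))) (bernoulli n 0≤h))
  where
  eq : ιℕ n ℚ.* (h ℚ.* h) ≡ (1ℚ ℚ.+ h) ℚ.* (1ℚ ℚ.+ ιℕ n ℚ.* h) ℚ.- (1ℚ ℚ.+ ιℕ (suc n) ℚ.* h)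
  eq = trans (solve 2 (λ n h → n :* (h :* h) := (con 1ℚ :+ h) :* (con 1ℚ :+ n :* h) :-
    (con 1ℚ :+ (con 1ℚ :+ n) :* h)) refl (ιℕ n) h)
    (cong (λ z → (1ℚ ℚ.+ h) ℚ.* (1ℚ ℚ.+ ιℕ n ℚ.* h) ℚ.- (1ℚ ℚ.+ z ℚ.* h)) (sym (ιℕ-+ 1 n)))

≤⇒≯ : ∀ {x y} → x ℚ.≤ y → ¬ (y ℚ.< x)
≤⇒≯ x≤y y<x = ℚ.<-irrefl refl (ℚ.≤-<-trans x≤y y<x)

1<^⇒1< : ∀ {x} n → 0ℚ ℚ.≤ x → 1ℚ ℚ.< x ^ℚ n → 1ℚ ℚ.< x
1<^⇒1< {x} n 0≤x 1<x^n with 1ℚ ℚ.<? x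
... | yes 1<x = 1<x
... | no  1≮x = contradiction 1<x^n (≤⇒≯ (subst (x ^ℚ n ℚ.≤_) (1^ n) (^-monoˡ-≤ n 0≤x (ℚ.≮⇒≥ 1≮x))))

archimedean : ∀ r → 0ℚ ℚ.< r → ∃[ k ] 1ℚ ℚ.< r ℚ.* ιℕ (suc k)
archimedean r@(mkℚ (+ suc n) d-1 _) 0<r = suc d-1 , (begin-strict
  1ℚ ≤⟨ ιℕ-mono-≤ {1} {suc n} (ℕ.s≤s ℕ.z≤n) ⟩
  ιℕ (suc n) ≡⟨ sym (x≡↥/↧ r) ⟩
  r ℚ.* ιℕ (suc d-1) <⟨ *-monoʳ-< 0<r (ιℕ-mono-< {suc d-1} {suc (suc d-1)} ℕ.≤-refl) ⟩
  r ℚ.* ιℕ (suc (suc d-1)) ∎)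
  where open ℚ.≤-Reasoning
archimedean (mkℚ (+ zero) _ _) 0<r with ℚ.positive 0<r
... | ()
archimedean (mkℚ -[1+ _ ] _ _) 0<r with ℚ.positive 0<r
... | ()

1<x*n⇒1/n<x : ∀ {M} .{{_ : ℕ.NonZero M}} {x} → 1ℚ ℚ.< x ℚ.* ιℕ M → + 1 ℚ./ M ℚ.< x
1<x*n⇒1/n<x {M} {x} 1<xM = *-cancelʳ-< (0≤ιℕ M)
  (subst (ℚ._< x ℚ.* ιℕ M) (sym (/-*-cancel (+ 1) M)) 1<xM)

0<1/ : ∀ M .{{_ : ℕ.NonZero M}} → 0ℚ ℚ.< + 1 ℚ./ M
0<1/ M = *-cancelʳ-< (0≤ιℕ M) (subst₂ ℚ._<_ (sym (ℚ.*-zeroˡ (ιℕ M))) (sym (/-*-cancel (+ 1) M)) 0<1)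

-- Estimates in ℕ

module _ where
  open ℕ.≤-Reasoning

  ^-distribʳ-* : ∀ o m n → (m ℕ.* n) ℕ.^ o ≡ m ℕ.^ o ℕ.* n ℕ.^ o
  ^-distribʳ-* zero    m n = refl
  ^-distribʳ-* (suc o) m n = trans (cong (m ℕ.* n ℕ.*_) (^-distribʳ-* o m n))
    (ℕS.solve 4 (λ m n x y → (m ℕS.:* n) ℕS.:* (x ℕS.:* y) ℕS.:= (m ℕS.:* x) ℕS.:* (n ℕS.:* y)) refl m n
      (m ℕ.^ o) (n ℕ.^ o))

  1≤fib : ∀ n → 1 ℕ.≤ fib n
  1≤fib 0             = ℕ.≤-refl
  1≤fib 1             = ℕ.≤-refl
  1≤fib (suc (suc n)) = ℕ.≤-trans (1≤fib n) (ℕ.m≤n+m (fib n) (fib (suc n)))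

  fib-step : ∀ n → fib n ℕ.≤ fib (suc n)
  fib-step zero    = ℕ.≤-refl
  fib-step (suc n) = ℕ.m≤m+n (fib (suc n)) (fib n)

  -- The growth condition controls bₙ₊₁ through Fₙ₊₁, while qₙ ≤ q only yields Fₙ ≤ q; this pays for
  -- the shift of index.
  fib-suc≤ : ∀ n → fib (suc n) ℕ.≤ 2 ℕ.* fib n
  fib-suc≤ zero    = ℕ.s≤s ℕ.z≤n
  fib-suc≤ (suc n) = ℕ.+-monoʳ-≤ (fib (suc n)) (ℕ.≤-trans (fib-step n) (ℕ.m≤m+n (fib (suc n)) 0))

  n≤fib : ∀ n → n ℕ.≤ fib n
  n≤fib 0             = ℕ.z≤n
  n≤fib 1             = ℕ.≤-refl
  n≤fib (suc (suc n)) = begin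
    suc (suc n)           ≡⟨ ℕ.+-comm 1 (suc n) ⟩
    suc n ℕ.+ 1             ≤⟨ ℕ.+-mono-≤ (n≤fib (suc n)) (1≤fib n) ⟩
    fib (suc n) ℕ.+ fib n   ∎

  -- Two steps at least double Fₙ, and 9 ≤ 2⁴. Powers of 3 are wanted because 3 replaces e in the
  -- growth hypothesis.
  3^≤fib^4 : ∀ n → 3 ℕ.^ suc n ℕ.≤ 16 ℕ.* fib n ℕ.^ 4
  3^≤fib^4 0             = ℕ.s≤s (ℕ.s≤s (ℕ.s≤s ℕ.z≤n))
  3^≤fib^4 1             = ℕ.m≤m+n 9 7
  3^≤fib^4 (suc (suc n)) = begin
    3 ℕ.* (3 ℕ.* 3 ℕ.^ suc n)       ≡⟨ sym (ℕ.*-assoc 3 3 (3 ℕ.^ suc n)) ⟩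
    9 ℕ.* 3 ℕ.^ suc n             ≤⟨ ℕ.*-mono-≤ (ℕ.m≤m+n 9 7) (3^≤fib^4 n) ⟩
    16 ℕ.* (16 ℕ.* fib n ℕ.^ 4)     ≡⟨ cong (16 ℕ.*_) (sym (^-distribʳ-* 4 2 (fib n))) ⟩
    16 ℕ.* (2 ℕ.* fib n) ℕ.^ 4      ≤⟨ ℕ.*-monoʳ-≤ 16
      (ℕ.^-monoˡ-≤ 4 (ℕ.+-mono-≤ (fib-step n) (ℕ.≤-reflexive (ℕ.+-identityʳ (fib n))))) ⟩
    16 ℕ.* fib (suc (suc n)) ℕ.^ 4 ∎

  ^-cancelˡ-< : ∀ {m n} o → m ℕ.^ o ℕ.< n ℕ.^ o → m ℕ.< n
  ^-cancelˡ-< {m} {n} o lt with m ℕ.<? n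
  ... | yes p = p
  ... | no ¬p = contradiction lt (ℕ.≤⇒≯ (ℕ.^-monoˡ-≤ o (ℕ.≮⇒≥ ¬p)))

  n<2^n : ∀ n → n ℕ.< 2 ℕ.^ n
  n<2^n zero    = ℕ.s≤s ℕ.z≤n
  n<2^n (suc n) = begin-strict
    suc n          <⟨ ℕ.s≤s (n<2^n n) ⟩
    1 ℕ.+ 2 ℕ.^ n      ≤⟨ ℕ.+-monoˡ-≤ (2 ℕ.^ n) (ℕ.m^n>0 2 n) ⟩
    2 ℕ.^ n ℕ.+ 2 ℕ.^ n  ≡⟨ cong (2 ℕ.^ n ℕ.+_) (sym (ℕ.+-identityʳ (2 ℕ.^ n))) ⟩
    2 ℕ.^ suc n      ∎

  -- With T = 2^(5k+1), (T B^k)^8 < 16 T^8 q^4 ≤ q^8 gives T B^k < q; then use q ≤ 2 (q - 1).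
  exponent-estimate : ∀ k B n q → B ℕ.^ (k ℕ.* 8) ℕ.< 3 ℕ.^ suc n → fib n ℕ.≤ q → 2 ℕ.≤ q →
    (2 ℕ.^ (5 ℕ.* k ℕ.+ 1)) ℕ.^ 8 ℕ.* 16 ℕ.≤ q →
    (8 ℕ.* (B ℕ.* (q ℕ.* q))) ℕ.^ k ℕ.< (q ℕ.∸ 1) ℕ.^ (2 ℕ.* k ℕ.+ 1)
  exponent-estimate k B n q B^<3^ fib≤q 2≤q T≤q = ℕ.*-cancelˡ-< (2 ℕ.^ (2 ℕ.* k ℕ.+ 1)) _ _
    (begin-strict
    2 ℕ.^ (2 ℕ.* k ℕ.+ 1) ℕ.* (8 ℕ.* (B ℕ.* (q ℕ.* q))) ℕ.^ k
      ≡⟨ cong (2 ℕ.^ (2 ℕ.* k ℕ.+ 1) ℕ.*_) (trans (^-distribʳ-* k 8 (B ℕ.* (q ℕ.* q)))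
        (cong₂ ℕ._*_ (ℕ.^-*-assoc 2 3 k) (^-distribʳ-* k B (q ℕ.* q)))) ⟩
    2 ℕ.^ (2 ℕ.* k ℕ.+ 1) ℕ.* (2 ℕ.^ (3 ℕ.* k) ℕ.* (B ℕ.^ k ℕ.* (q ℕ.* q) ℕ.^ k))
      ≡⟨ ℕS.solve 4 (λ x y z w → x ℕS.:* (y ℕS.:* (z ℕS.:* w)) ℕS.:= x ℕS.:* y ℕS.:* z ℕS.:* w) refl
        (2 ℕ.^ (2 ℕ.* k ℕ.+ 1)) (2 ℕ.^ (3 ℕ.* k)) (B ℕ.^ k) ((q ℕ.* q) ℕ.^ k) ⟩
    2 ℕ.^ (2 ℕ.* k ℕ.+ 1) ℕ.* 2 ℕ.^ (3 ℕ.* k) ℕ.* B ℕ.^ k ℕ.* (q ℕ.* q) ℕ.^ k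
      ≡⟨ cong (λ z → z ℕ.* B ℕ.^ k ℕ.* (q ℕ.* q) ℕ.^ k)
        (trans (sym (ℕ.^-distribˡ-+-* 2 (2 ℕ.* k ℕ.+ 1) (3 ℕ.* k)))
        (cong (2 ℕ.^_) (ℕS.solve 1 (λ k → (ℕS.con 2 ℕS.:* k ℕS.:+ ℕS.con 1) ℕS.:+ ℕS.con 3 ℕS.:* k ℕS.:=
        ℕS.con 5 ℕS.:* k ℕS.:+ ℕS.con 1) refl k))) ⟩
    T ℕ.* B ℕ.^ k ℕ.* (q ℕ.* q) ℕ.^ k
      <⟨ ℕ.*-monoˡ-< ((q ℕ.* q) ℕ.^ k) {{ℕ.m^n≢0 (q ℕ.* q) k {{ℕ.m*n≢0 q q}}}} TB<q ⟩
    q ℕ.* (q ℕ.* q) ℕ.^ k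
      ≡⟨ cong (q ℕ.*_) (trans (cong (λ z → (q ℕ.* z) ℕ.^ k) (sym (ℕ.*-identityʳ q)))
        (ℕ.^-*-assoc q 2 k)) ⟩
    q ℕ.^ suc (2 ℕ.* k)
      ≡⟨ cong (q ℕ.^_) (ℕ.+-comm 1 (2 ℕ.* k)) ⟩
    q ℕ.^ (2 ℕ.* k ℕ.+ 1)
      ≤⟨ ℕ.^-monoˡ-≤ (2 ℕ.* k ℕ.+ 1) q≤ ⟩
    (2 ℕ.* (q ℕ.∸ 1)) ℕ.^ (2 ℕ.* k ℕ.+ 1)
      ≡⟨ ^-distribʳ-* (2 ℕ.* k ℕ.+ 1) 2 (q ℕ.∸ 1) ⟩
    2 ℕ.^ (2 ℕ.* k ℕ.+ 1) ℕ.* (q ℕ.∸ 1) ℕ.^ (2 ℕ.* k ℕ.+ 1) ∎)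
    where
    -- The exponent is 3k from the factor 8^k, plus 2k + 1 from q ≤ 2 (q - 1) raised to the power 2k
    -- + 1.
    T = 2 ℕ.^ (5 ℕ.* k ℕ.+ 1)
    instance
      q≢0 : ℕ.NonZero q
      q≢0 = ℕ.>-nonZero (ℕ.≤-trans (ℕ.s≤s ℕ.z≤n) 2≤q)
    q≤ : q ℕ.≤ 2 ℕ.* (q ℕ.∸ 1)
    q≤ = begin
      q                      ≡⟨ sym (ℕ.m∸n+n≡m {q} {1} (ℕ.≤-trans (ℕ.s≤s ℕ.z≤n) 2≤q)) ⟩
      q ℕ.∸ 1 ℕ.+ 1              ≤⟨ ℕ.+-monoʳ-≤ (q ℕ.∸ 1) (ℕ.∸-monoˡ-≤ 1 2≤q) ⟩
      q ℕ.∸ 1 ℕ.+ (q ℕ.∸ 1)        ≡⟨ cong (q ℕ.∸ 1 ℕ.+_) (sym (ℕ.+-identityʳ (q ℕ.∸ 1))) ⟩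
      2 ℕ.* (q ℕ.∸ 1)            ∎
    TB<q : T ℕ.* B ℕ.^ k ℕ.< q
    TB<q = ^-cancelˡ-< 8 (begin-strict
      (T ℕ.* B ℕ.^ k) ℕ.^ 8        ≡⟨ ^-distribʳ-* 8 T (B ℕ.^ k) ⟩
      T ℕ.^ 8 ℕ.* (B ℕ.^ k) ℕ.^ 8    ≡⟨ cong (T ℕ.^ 8 ℕ.*_) (ℕ.^-*-assoc B k 8) ⟩
      T ℕ.^ 8 ℕ.* B ℕ.^ (k ℕ.* 8)    <⟨ ℕ.*-monoʳ-< (T ℕ.^ 8)
        {{ℕ.m^n≢0 T 8 {{ℕ.m^n≢0 2 (5 ℕ.* k ℕ.+ 1)}}}} B^<3^ ⟩
      T ℕ.^ 8 ℕ.* 3 ℕ.^ suc n      ≤⟨ ℕ.*-monoʳ-≤ (T ℕ.^ 8)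
        (ℕ.≤-trans (3^≤fib^4 n) (ℕ.*-monoʳ-≤ 16 (ℕ.^-monoˡ-≤ 4 fib≤q))) ⟩
      T ℕ.^ 8 ℕ.* (16 ℕ.* q ℕ.^ 4)   ≡⟨ sym (ℕ.*-assoc (T ℕ.^ 8) 16 (q ℕ.^ 4)) ⟩
      T ℕ.^ 8 ℕ.* 16 ℕ.* q ℕ.^ 4     ≤⟨ ℕ.*-monoˡ-≤ (q ℕ.^ 4) T≤q ⟩
      q ℕ.^ 5                  ≤⟨ ℕ.^-monoʳ-≤ q (ℕ.m≤m+n 5 3) ⟩
      q ℕ.^ 8                  ∎)

  -- With i = ⌊(q - 2) / k⌋, q ≤ (k + 1)(i + 1) gives B² < 2^(i+1) and bounds q⁴ by a polynomial in i.
  base-estimate : ∀ k .{{_ : ℕ.NonZero k}} B n q → B ℕ.^ (2 ℕ.* (4 ℕ.* suc k)) ℕ.< 3 ℕ.^ fib (suc n) →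
    fib n ℕ.≤ q → 2 ℕ.≤ q → 5 ℕ.* suc k ℕ.* (128 ℕ.* (5 ℕ.* suc k) ℕ.^ 4) ℕ.≤ q →
    8 ℕ.* (B ℕ.* (q ℕ.* q)) ℕ.< 2 ℕ.^ ((q ℕ.∸ 2) ℕ./ k)
  base-estimate k B n q B^<3^ fib≤q 2≤q T≤q = ^-cancelˡ-< 2 (begin-strict
    (8 ℕ.* (B ℕ.* (q ℕ.* q))) ℕ.^ 2
      ≡⟨ ℕS.solve 2 (λ B q → (ℕS.con 8 ℕS.:* (B ℕS.:* (q ℕS.:* q))) ℕS.:*
        ((ℕS.con 8 ℕS.:* (B ℕS.:* (q ℕS.:* q))) ℕS.:* ℕS.con 1) ℕS.:= ℕS.con 64 ℕS.:*
        (B ℕS.:* (B ℕS.:* ℕS.con 1)) ℕS.:* (q ℕS.:* (q ℕS.:* (q ℕS.:* (q ℕS.:* ℕS.con 1))))) refl B q ⟩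
    64 ℕ.* B ℕ.^ 2 ℕ.* q ℕ.^ 4
      <⟨ ℕ.*-monoˡ-< (q ℕ.^ 4) {{ℕ.m^n≢0 q 4}} (ℕ.*-monoʳ-< 64 B²<) ⟩
    64 ℕ.* 2 ℕ.^ suc i ℕ.* q ℕ.^ 4
      ≡⟨ ℕS.solve 2 (λ x y → ℕS.con 64 ℕS.:* (ℕS.con 2 ℕS.:* x) ℕS.:* y ℕS.:= ℕS.con 128 ℕS.:* y ℕS.:*
        x) refl (2 ℕ.^ i) (q ℕ.^ 4) ⟩
    128 ℕ.* q ℕ.^ 4 ℕ.* 2 ℕ.^ i
      ≤⟨ ℕ.*-monoˡ-≤ (2 ℕ.^ i) 128q⁴≤ ⟩
    2 ℕ.^ i ℕ.* 2 ℕ.^ i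
      ≡⟨ cong (2 ℕ.^ i ℕ.*_) (sym (ℕ.*-identityʳ (2 ℕ.^ i))) ⟩
    (2 ℕ.^ i) ℕ.^ 2 ∎)
    where
    i = (q ℕ.∸ 2) ℕ./ k
    -- Since 5j ≤ i, 2^i dominates (j + 1)⁵, one degree more than q⁴ ≤ D⁴ (j + 1)⁴ requires. The
    -- spare factor j + 1 absorbs 128 D⁴, because the threshold on q is D times that constant and q
    -- ≤ D (j + 1).
    j = i ℕ./ 5
    D = 5 ℕ.* suc k
    instance
      q≢0 : ℕ.NonZero q
      q≢0 = ℕ.>-nonZero (ℕ.≤-trans (ℕ.s≤s ℕ.z≤n) 2≤q)
    q≤ : q ℕ.≤ suc k ℕ.* suc i
    q≤ = begin
      q                              ≡⟨ sym (ℕ.m∸n+n≡m {q} {2} 2≤q) ⟩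
      q ℕ.∸ 2 ℕ.+ 2                      ≡⟨ cong (ℕ._+ 2) (ℕ.m≡m%n+[m/n]*n (q ℕ.∸ 2) k) ⟩
      (q ℕ.∸ 2) ℕ.% k ℕ.+ i ℕ.* k ℕ.+ 2        ≡⟨ ℕS.solve 2
        (λ r x → r ℕS.:+ x ℕS.:+ ℕS.con 2 ℕS.:= (ℕS.con 1 ℕS.:+ r) ℕS.:+ x ℕS.:+ ℕS.con 1) refl
        ((q ℕ.∸ 2) ℕ.% k) (i ℕ.* k) ⟩
      suc ((q ℕ.∸ 2) ℕ.% k) ℕ.+ i ℕ.* k ℕ.+ 1  ≤⟨ ℕ.+-mono-≤
        (ℕ.+-monoˡ-≤ (i ℕ.* k) (ℕ.m%n<n (q ℕ.∸ 2) k)) (ℕ.s≤s ℕ.z≤n) ⟩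
      k ℕ.+ i ℕ.* k ℕ.+ suc i              ≡⟨ ℕS.solve 2
        (λ k i → k ℕS.:+ i ℕS.:* k ℕS.:+ (ℕS.con 1 ℕS.:+ i) ℕS.:= (ℕS.con 1 ℕS.:+ k) ℕS.:*
        (ℕS.con 1 ℕS.:+ i)) refl k i ⟩
      suc k ℕ.* suc i                  ∎
    1+i≤ : suc i ℕ.≤ 5 ℕ.* suc j
    1+i≤ = begin
      suc i                  ≡⟨ cong suc (ℕ.m≡m%n+[m/n]*n i 5) ⟩
      suc (i ℕ.% 5) ℕ.+ j ℕ.* 5    ≤⟨ ℕ.+-monoˡ-≤ (j ℕ.* 5) (ℕ.m%n<n i 5) ⟩
      5 ℕ.+ j ℕ.* 5              ≡⟨ ℕ.*-comm (suc j) 5 ⟩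
      5 ℕ.* suc j              ∎
    q≤Dj : q ℕ.≤ D ℕ.* suc j
    q≤Dj = begin
      q                    ≤⟨ q≤ ⟩
      suc k ℕ.* suc i        ≤⟨ ℕ.*-monoʳ-≤ (suc k) 1+i≤ ⟩
      suc k ℕ.* (5 ℕ.* suc j)  ≡⟨ ℕS.solve 2 (λ k j → k ℕS.:* (ℕS.con 5 ℕS.:* j) ℕS.:= ℕS.con 5 ℕS.:* k
        ℕS.:* j) refl (suc k) (suc j) ⟩
      D ℕ.* suc j            ∎
    128q⁴≤ : 128 ℕ.* q ℕ.^ 4 ℕ.≤ 2 ℕ.^ i
    128q⁴≤ = begin
      128 ℕ.* q ℕ.^ 4              ≤⟨ ℕ.*-monoʳ-≤ 128 (ℕ.^-monoˡ-≤ 4 q≤Dj) ⟩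
      128 ℕ.* (D ℕ.* suc j) ℕ.^ 4    ≡⟨ cong (128 ℕ.*_) (^-distribʳ-* 4 D (suc j)) ⟩
      128 ℕ.* (D ℕ.^ 4 ℕ.* suc j ℕ.^ 4) ≡⟨ sym (ℕ.*-assoc 128 (D ℕ.^ 4) (suc j ℕ.^ 4)) ⟩
      128 ℕ.* D ℕ.^ 4 ℕ.* suc j ℕ.^ 4  ≤⟨ ℕ.*-monoˡ-≤ (suc j ℕ.^ 4)
        (ℕ.*-cancelˡ-≤ D (ℕ.≤-trans T≤q q≤Dj)) ⟩
      suc j ℕ.^ 5                ≤⟨ ℕ.^-monoˡ-≤ 5 (n<2^n j) ⟩
      (2 ℕ.^ j) ℕ.^ 5              ≡⟨ ℕ.^-*-assoc 2 j 5 ⟩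
      2 ℕ.^ (j ℕ.* 5)              ≤⟨ ℕ.^-monoʳ-≤ 2 (ℕ.m/n*n≤m i 5) ⟩
      2 ℕ.^ i                    ∎
    -- Rounding 3 up to 4 = 2² and using Fₙ₊₁ ≤ 2q gives the exponent 4q ≤ 4 (k + 1) (i + 1); this
    -- is the origin of the factor 4 (k + 1) in the assumed power of B.
    B²< : B ℕ.^ 2 ℕ.< 2 ℕ.^ suc i
    B²< = ^-cancelˡ-< (4 ℕ.* suc k) (begin-strict
      (B ℕ.^ 2) ℕ.^ (4 ℕ.* suc k)       ≡⟨ ℕ.^-*-assoc B 2 (4 ℕ.* suc k) ⟩
      B ℕ.^ (2 ℕ.* (4 ℕ.* suc k))       <⟨ B^<3^ ⟩
      3 ℕ.^ fib (suc n)             ≤⟨ ℕ.^-monoˡ-≤ (fib (suc n)) (ℕ.s≤s (ℕ.s≤s (ℕ.s≤s ℕ.z≤n))) ⟩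
      4 ℕ.^ fib (suc n)             ≤⟨ ℕ.^-monoʳ-≤ 4 (ℕ.≤-trans (fib-suc≤ n) (ℕ.*-monoʳ-≤ 2 fib≤q)) ⟩
      4 ℕ.^ (2 ℕ.* q)                 ≡⟨ ℕ.^-*-assoc 2 2 (2 ℕ.* q) ⟩
      2 ℕ.^ (2 ℕ.* (2 ℕ.* q))           ≤⟨ ℕ.^-monoʳ-≤ 2 (ℕ.*-monoʳ-≤ 2 (ℕ.*-monoʳ-≤ 2 q≤)) ⟩
      2 ℕ.^ (2 ℕ.* (2 ℕ.* (suc k ℕ.* suc i))) ≡⟨ cong (2 ℕ.^_)
        (ℕS.solve 2 (λ k i → ℕS.con 2 ℕS.:* (ℕS.con 2 ℕS.:* (k ℕS.:* i)) ℕS.:= i ℕS.:*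
        (ℕS.con 4 ℕS.:* k)) refl (suc k) (suc i)) ⟩
      2 ℕ.^ (suc i ℕ.* (4 ℕ.* suc k))   ≡⟨ sym (ℕ.^-*-assoc 2 (suc i) (4 ℕ.* suc k)) ⟩
      (2 ℕ.^ suc i) ℕ.^ (4 ℕ.* suc k)   ∎)

-- Real powers and logarithms

x<x+1 : ∀ x → x ℚ.< x ℚ.+ 1ℚ
x<x+1 x = subst (ℚ._< x ℚ.+ 1ℚ) (ℚ.+-identityʳ x) (ℚ.+-monoʳ-< x 0<1)

fromℚ-isReal : ∀ p → IsReal (fromℚ p)
fromℚ-isReal p = record
  { lower-inhabited = p ℚ.- 1ℚ , subst (p ℚ.- 1ℚ ℚ.<_)
    (solve 1 (λ p → (p :- con 1ℚ) :+ con 1ℚ := p) refl p) (x<x+1 (p ℚ.- 1ℚ))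
  ; upper-inhabited = p ℚ.+ 1ℚ , x<x+1 p
  ; lower-closed    = ℚ.<-trans
  ; upper-closed    = λ r<s p<r → ℚ.<-trans p<r r<s
  ; lower-open      = λ r<p → let (s , r<s , s<p) = ℚ.<-dense r<p in s , r<s , s<p
  ; upper-open      = λ p<s → let (r , p<r , r<s) = ℚ.<-dense p<s in r , r<s , p<r
  ; disjoint        = λ (r<p , p<r) → ℚ.<-asym r<p p<r
  ; located         = located
  }
  where
  located : ∀ {r s} → r ℚ.< s → r ℚ.< p ⊎ p ℚ.< s
  located {r} r<s with r ℚ.<? p
  ... | yes r<p = inj₁ r<p
  ... | no  r≮p = inj₂ (ℚ.≤-<-trans (ℚ.≮⇒≥ r≮p) r<s)

lower<upper : ∀ {x r s} → IsReal x → lower x r → upper x s → r ℚ.< s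
lower<upper {x} {r} {s} xR l u with ℚ.<-cmp r s
... | tri< r<s _ _ = r<s
... | tri≈ _ refl _ = contradiction (l , u) (IsReal.disjoint xR)
... | tri> _ _ s<r = contradiction (IsReal.lower-closed xR s<r l , u) (IsReal.disjoint xR)

-- Bounds for e, and the growth hypothesis in integer form

2^n≤[1+n]! : ∀ n → 2 ℕ.^ n ℕ.≤ suc n !
2^n≤[1+n]! zero    = ℕ.≤-refl
2^n≤[1+n]! (suc n) = ℕ.*-mono-≤ {2} {suc (suc n)} (ℕ.s≤s (ℕ.s≤s ℕ.z≤n)) (2^n≤[1+n]! n)

1/[1+n]!≤½^n : ∀ n → ((+ 1) ℚ./ (suc n !)) {{suc n ℕ.!≢0}} ℚ.≤ ½ ^ℚ n
1/[1+n]!≤½^n n = *-cancelʳ-≤ {ιℕ m} (ιℕ-mono-< {0} {m} (ℕ.n≢0⇒n>0 (ℕ.≢-nonZero⁻¹ m {{suc n ℕ.!≢0}})))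
  (begin
  ((+ 1) ℚ./ m) {{suc n ℕ.!≢0}} ℚ.* ιℕ m ≡⟨ /-*-cancel (+ 1) m {{suc n ℕ.!≢0}} ⟩
  1ℚ                    ≡⟨ sym (1^ n) ⟩
  (½ ℚ.* ιℕ 2) ^ℚ n     ≡⟨ ^-distrib-* ½ (ιℕ 2) n ⟩
  ½ ^ℚ n ℚ.* ιℕ 2 ^ℚ n  ≡⟨ cong (½ ^ℚ n ℚ.*_) (sym (ιℕ-^ 2 n)) ⟩
  ½ ^ℚ n ℚ.* ιℕ (2 ℕ.^ n) ≤⟨ *-monoʳ-≤ (0≤^ n 0≤½) (ιℕ-mono-≤ {2 ℕ.^ n} {m} (2^n≤[1+n]! n)) ⟩
  ½ ^ℚ n ℚ.* ιℕ m ∎)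
  where
  open ℚ.≤-Reasoning
  m = suc n !
  0≤½ : 0ℚ ℚ.≤ ½
  0≤½ = ℚ.nonNegative⁻¹ ½

-- The added 2 / 2^n is a reserve that closes the induction: the next summand 1/(n+1)! ≤ 1 / 2^n
-- consumes at most half of it.
expSum≤ : ∀ n → expSum n ℚ.+ (½ ^ℚ n ℚ.+ ½ ^ℚ n) ℚ.≤ ιℕ 3
expSum≤ zero    = ℚ.≤-refl
expSum≤ (suc n) = begin
  expSum n ℚ.+ f ℚ.+ (½ ℚ.* h ℚ.+ ½ ℚ.* h) ≡⟨ solve 3
    (λ e f h → (e :+ f) :+ (con ½ :* h :+ con ½ :* h) := e :+ (f :+ h)) refl (expSum n) f h ⟩
  expSum n ℚ.+ (f ℚ.+ h) ≤⟨ ℚ.+-monoʳ-≤ (expSum n) (ℚ.+-monoˡ-≤ h (1/[1+n]!≤½^n n)) ⟩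
  expSum n ℚ.+ (h ℚ.+ h) ≤⟨ expSum≤ n ⟩
  ιℕ 3 ∎
  where
  open ℚ.≤-Reasoning
  h = ½ ^ℚ n
  f = ((+ 1) ℚ./ (suc n !)) {{suc n ℕ.!≢0}}

lower-e⇒<3 : ∀ {r} → lower e r → r ℚ.< ιℕ 3
lower-e⇒<3 (n , r<) = ℚ.<-≤-trans r< (ℚ.≤-trans
  (subst (ℚ._≤ expSum n ℚ.+ (h ℚ.+ h)) (ℚ.+-identityʳ (expSum n))
  (ℚ.+-monoʳ-≤ (expSum n) (ℚ.+-mono-≤ {0ℚ} {h} {0ℚ} {h} 0≤h 0≤h))) (expSum≤ n))
  where
  h = ½ ^ℚ n
  0≤h : 0ℚ ℚ.≤ h
  0≤h = 0≤^ n (ℚ.nonNegative⁻¹ ½)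

upper-e⇒1< : ∀ {r} → upper e r → 1ℚ ℚ.< r
upper-e⇒1< (s , s<r , sup) = ℚ.≤-<-trans (sup 0) s<r

-- The witness is a box around (e , s) with left exponent c < s, and two of its corners are used. At
-- the upper base b > 1, r < b^c with r ≥ 1 forces c > 0. At the lower base a < 3, B < r < a^c gives
-- B < 3^c, stated with the denominator of c cleared.
<e^s⇒<3^c : ∀ {B s r} → 1 ℕ.≤ B → ιℕ B ℚ.< r → lower (e ^ fromℚ s) r →
  ∃[ c ] 0ℚ ℚ.< c × c ℚ.< s × B ℕ.^ ↧ₙ c ℕ.< 3 ℕ.^ ((↥ c) ⁺)
<e^s⇒<3^c {B} {s} {r} 1≤B B<r (a , b , c , _ , (la , ub , c<s , _) , ((0<a , ac) , _ , (0<b , bc) , _))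
  = go c c<s ac bc
  where
  0<r : 0ℚ ℚ.< r
  0<r = ℚ.≤-<-trans (0≤ιℕ B) B<r
  1≤r : 1ℚ ℚ.≤ r
  1≤r = ℚ.≤-trans (ιℕ-mono-≤ {1} {B} 1≤B) (ℚ.<⇒≤ B<r)
  1≤r^*b^ : ∀ m n → 1ℚ ℚ.≤ r ^ℚ m ℚ.* b ^ℚ n
  1≤r^*b^ m n = *-mono-≤ {1ℚ} {r ^ℚ m} {1ℚ} {b ^ℚ n} (ℚ.<⇒≤ 0<1) (0≤^ m (ℚ.<⇒≤ 0<r)) (1≤^ m 1≤r)
    (1≤^ n (ℚ.<⇒≤ (upper-e⇒1< ub)))
  Q : ℚ → ℚ → Set
  Q a c = r ℚ.≤ 0ℚ ⊎ r ^ℚ (↧ₙ c) ℚ.* a ^ℚ ((↥ c) ⁻) ℚ.< a ^ℚ ((↥ c) ⁺)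
  go : ∀ c → c ℚ.< s → Q a c → Q b c → ∃[ c ] 0ℚ ℚ.< c × c ℚ.< s × B ℕ.^ ↧ₙ c ℕ.< 3 ℕ.^ ((↥ c) ⁺)
  go _ _ (inj₁ r≤0) _ = contradiction 0<r (≤⇒≯ r≤0)
  go _ _ _ (inj₁ r≤0) = contradiction 0<r (≤⇒≯ r≤0)
  go c@(mkℚ (+ zero) _ _) c<s _ (inj₂ bc) = contradiction bc (≤⇒≯ (1≤r^*b^ (↧ₙ c) 0))
  go c@(mkℚ -[1+ n ] _ _) c<s _ (inj₂ bc) = contradiction bc (≤⇒≯ (1≤r^*b^ (↧ₙ c) (suc n)))
  go c@(mkℚ (+ suc n) d-1 _) c<s (inj₂ ac) _ = c , ℚ.positive⁻¹ c , c<s , ιℕ-cancel-< {B ℕ.^ suc d-1}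
    {3 ℕ.^ suc n} (begin-strict
    ιℕ (B ℕ.^ suc d-1) ≡⟨ ιℕ-^ B (suc d-1) ⟩
    ιℕ B ^ℚ suc d-1 ≤⟨ ^-monoˡ-≤ (suc d-1) (0≤ιℕ B) (ℚ.<⇒≤ B<r) ⟩
    r ^ℚ suc d-1 ≡⟨ sym (ℚ.*-identityʳ (r ^ℚ suc d-1)) ⟩
    r ^ℚ suc d-1 ℚ.* 1ℚ <⟨ ac ⟩
    a ^ℚ suc n ≤⟨ ^-monoˡ-≤ (suc n) (ℚ.<⇒≤ 0<a) (ℚ.<⇒≤ (lower-e⇒<3 la)) ⟩
    ιℕ 3 ^ℚ suc n ≡⟨ sym (ιℕ-^ 3 (suc n)) ⟩
    ιℕ (3 ℕ.^ suc n) ∎)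
    where open ℚ.≤-Reasoning

-- In terms of logarithms to base 3, log B < n/d < g/K. Without them, the negated conclusion is
-- raised to the power d and the first hypothesis to the power K.
^-cancel-exponents : ∀ B d n K g → 0 ℕ.< K → B ℕ.^ d ℕ.< 3 ℕ.^ n → n ℕ.* K ℕ.< g ℕ.* d →
  B ℕ.^ K ℕ.< 3 ℕ.^ g
^-cancel-exponents B d n K g 0<K lt nK<gd with B ℕ.^ K ℕ.<? 3 ℕ.^ g
... | yes p = p
... | no ¬p = contradiction (ℕ.^-monoʳ-< 3 (ℕ.s≤s (ℕ.s≤s ℕ.z≤n)) nK<gd) (ℕ.≤⇒≯ (begin
  3 ℕ.^ (g ℕ.* d) ≡⟨ sym (ℕ.^-*-assoc 3 g d) ⟩
  (3 ℕ.^ g) ℕ.^ d ≤⟨ ℕ.^-monoˡ-≤ d (ℕ.≮⇒≥ ¬p) ⟩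
  (B ℕ.^ K) ℕ.^ d ≡⟨ trans (ℕ.^-*-assoc B K d)
    (trans (cong (B ℕ.^_) (ℕ.*-comm K d)) (sym (ℕ.^-*-assoc B d K))) ⟩
  (B ℕ.^ d) ℕ.^ K ≤⟨ ℕ.^-monoˡ-≤ K (ℕ.<⇒≤ lt) ⟩
  (3 ℕ.^ n) ℕ.^ K ≡⟨ ℕ.^-*-assoc 3 n K ⟩
  3 ℕ.^ (n ℕ.* K) ∎))
  where open ℕ.≤-Reasoning

-- The upper right corner of the product box suffices: it supplies ln B < u and 1/g < 1/l < v with u
-- v < 1/K, whence u K < l < g. Any c < u with B < 3^c then has c K < g.
ln÷-bound : ∀ {i} B g K .{{_ : ℕ.NonZero K}} → i ≡ + B → 1 ℕ.≤ B →
  ∣ ln (fromℤ i) ÷ fromℕ g - fromℕ 0 ∣ < fromℚ (+ 1 ℚ./ K) → B ℕ.^ K ℕ.< 3 ℕ.^ g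
ln÷-bound B g K refl 1≤B (r , ((s , t , (_ , u , _ , v ,
  (_ , (r′ , B<r′ , r′<e^u) , _ , (l , 0<l , l<g , 1<vl)) , (_ , _ , _ , uv<s)) , -t<0 , s+t≡r) , _) ,
  r<1/K)
  with <e^s⇒<3^c {B} {u} 1≤B B<r′ r′<e^u
... | c , 0<c , c<u , B^<3^ = finish c 0<c c<u B^<3^
  where
  1/K = + 1 ℚ./ K
  0<t : 0ℚ ℚ.< t
  0<t = subst (0ℚ ℚ.<_) (solve 1 (λ t → con 0ℚ :- (:- t) := t) refl t) (<⇒0<- -t<0)
  s<1/K : s ℚ.< 1/K
  s<1/K = ℚ.<-trans (subst₂ ℚ._<_ (ℚ.+-identityʳ s) s+t≡r (ℚ.+-monoʳ-< s 0<t)) r<1/K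
  0<K : 0 ℕ.< K
  0<K = ℕ.n≢0⇒n>0 (ℕ.≢-nonZero⁻¹ K)
  finish : ∀ c → 0ℚ ℚ.< c → c ℚ.< u → B ℕ.^ ↧ₙ c ℕ.< 3 ℕ.^ ((↥ c) ⁺) → B ℕ.^ K ℕ.< 3 ℕ.^ g
  finish (mkℚ (+ zero) _ _) 0<c _ _ with ℚ.positive 0<c
  ... | ()
  finish (mkℚ -[1+ _ ] _ _) 0<c _ _ with ℚ.positive 0<c
  ... | ()
  finish c@(mkℚ (+ suc n) d-1 _) 0<c c<u B^<3^ = ^-cancel-exponents B (suc d-1) (suc n) K g 0<K B^<3^
    (ιℕ-cancel-< {suc n ℕ.* K} {g ℕ.* suc d-1} (begin-strict
      ιℕ (suc n ℕ.* K) ≡⟨ ιℕ-* (suc n) K ⟩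
      ιℕ (suc n) ℚ.* ιℕ K ≡⟨ cong (ℚ._* ιℕ K) (sym (x≡↥/↧ c)) ⟩
      c ℚ.* ιℕ (suc d-1) ℚ.* ιℕ K ≡⟨ solve 3 (λ c d k → (c :* d) :* k := (c :* k) :* d) refl c
        (ιℕ (suc d-1)) (ιℕ K) ⟩
      c ℚ.* ιℕ K ℚ.* ιℕ (suc d-1) <⟨ *-monoˡ-< (ιℕ-mono-< {0} {suc d-1} (ℕ.s≤s ℕ.z≤n)) cK<g ⟩
      ιℕ g ℚ.* ιℕ (suc d-1) ≡⟨ sym (ιℕ-* g (suc d-1)) ⟩
      ιℕ (g ℕ.* suc d-1) ∎))
    where
    open ℚ.≤-Reasoning
    0<u = ℚ.<-trans 0<c c<u
    0<ιK : 0ℚ ℚ.< ιℕ K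
    0<ιK = ιℕ-mono-< {0} {K} 0<K
    cK<g : c ℚ.* ιℕ K ℚ.< ιℕ g
    cK<g = begin-strict
      c ℚ.* ιℕ K <⟨ *-monoˡ-< 0<ιK (begin-strict
        c <⟨ c<u ⟩
        u ≡⟨ sym (ℚ.*-identityʳ u) ⟩
        u ℚ.* 1ℚ <⟨ *-monoʳ-< 0<u 1<vl ⟩
        u ℚ.* (v ℚ.* l) ≡⟨ sym (ℚ.*-assoc u v l) ⟩
        u ℚ.* v ℚ.* l <⟨ *-monoˡ-< 0<l (ℚ.<-trans uv<s s<1/K) ⟩
        1/K ℚ.* l ∎) ⟩
      1/K ℚ.* l ℚ.* ιℕ K ≡⟨ solve 3 (λ i l k → (i :* l) :* k := (i :* k) :* l) refl 1/K l (ιℕ K) ⟩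
      1/K ℚ.* ιℕ K ℚ.* l ≡⟨ cong (ℚ._* l) (/-*-cancel (+ 1) K) ⟩
      1ℚ ℚ.* l ≡⟨ ℚ.*-identityˡ l ⟩
      l <⟨ l<g ⟩
      ιℕ g ∎

-- Rational witnesses for real powers

-- M < A^(n/k) ≤ a^(-s), and reciprocals give a^s < 1/M.
abovePow : ∀ n M A k {a s} .{{_ : ℕ.NonZero M}} → 1 ℕ.≤ A → M ℕ.^ k ℕ.< A ℕ.^ n →
  ιℕ A ℚ.≤ a → 0ℚ ℚ.< ℚ.- s → ιℕ n ℚ.≤ (ℚ.- s) ℚ.* ιℕ k → AbovePow (+ 1 ℚ./ M) a s
abovePow n M A k {a} {s@(mkℚ (+ m) d-1 _)} 1≤A M^<A^ A≤a 0<-s n≤-sk = contradiction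
  (subst₂ ℚ._<_ (ℚ.+-identityʳ s) (ℚ.+-inverseʳ s) (ℚ.+-monoʳ-< s 0<-s)) (≤⇒≯ (ℚ.nonNegative⁻¹ s))
abovePow n M A k {a} {s@(mkℚ -[1+ m ] d-1 _)} 1≤A M^<A^ A≤a 0<-s n≤-sk = 0<a , 0<1/ M , (begin-strict
  1ℚ                                   ≡⟨ sym (trans (cong (_^ℚ d) (/-*-cancel (+ 1) M)) (1^ d)) ⟩
  (i ℚ.* ιℕ M) ^ℚ d                    ≡⟨ ^-distrib-* i (ιℕ M) d ⟩
  i ^ℚ d ℚ.* ιℕ M ^ℚ d                 ≡⟨ cong (i ^ℚ d ℚ.*_) (sym (ιℕ-^ M d)) ⟩
  i ^ℚ d ℚ.* ιℕ (M ℕ.^ d)              <⟨ *-monoʳ-< (0<^ d (0<1/ M))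
    (ιℕ-mono-< {M ℕ.^ d} {A ℕ.^ suc m} M^d<) ⟩
  i ^ℚ d ℚ.* ιℕ (A ℕ.^ suc m)          ≡⟨ cong (i ^ℚ d ℚ.*_) (ιℕ-^ A (suc m)) ⟩
  i ^ℚ d ℚ.* ιℕ A ^ℚ suc m             ≤⟨ *-monoʳ-≤ (0≤^ d (ℚ.<⇒≤ (0<1/ M)))
    (^-monoˡ-≤ (suc m) (0≤ιℕ A) A≤a) ⟩
  i ^ℚ d ℚ.* a ^ℚ suc m ∎)
  where
  open ℚ.≤-Reasoning
  i = + 1 ℚ./ M
  d = suc d-1
  0<a : 0ℚ ℚ.< a
  0<a = ℚ.<-≤-trans (ιℕ-mono-< {0} {A} 1≤A) A≤a
  nd≤mk : n ℕ.* d ℕ.≤ suc m ℕ.* k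
  nd≤mk = ℕ.≮⇒≥ λ lt → ≤⇒≯ (begin
    ιℕ (n ℕ.* d)             ≡⟨ ιℕ-* n d ⟩
    ιℕ n ℚ.* ιℕ d            ≤⟨ *-monoˡ-≤ (0≤ιℕ d) n≤-sk ⟩
    (ℚ.- s) ℚ.* ιℕ k ℚ.* ιℕ d ≡⟨ solve 3 (λ s k d → (:- s) :* k :* d := :- (s :* d) :* k) refl s (ιℕ k)
      (ιℕ d) ⟩
    (ℚ.- (s ℚ.* ιℕ d)) ℚ.* ιℕ k ≡⟨ cong (ℚ._* ιℕ k) (trans (cong ℚ.-_ (x≡↥/↧ s)) (sym (ι-neg -[1+ m ]))) ⟩
    ιℕ (suc m) ℚ.* ιℕ k      ≡⟨ sym (ιℕ-* (suc m) k) ⟩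
    ιℕ (suc m ℕ.* k) ∎) (ιℕ-mono-< {suc m ℕ.* k} {n ℕ.* d} lt)
  M^d< : M ℕ.^ d ℕ.< A ℕ.^ suc m
  M^d< = ^-cancelˡ-< k (ℕ.<-≤-trans
    (subst₂ ℕ._<_ (trans (ℕ.^-*-assoc M k d) (trans (cong (M ℕ.^_) (ℕ.*-comm k d))
      (sym (ℕ.^-*-assoc M d k)))) (ℕ.^-*-assoc A n d)
      (ℕ.^-monoˡ-< d M^<A^))
    (ℕ.≤-trans (ℕ.^-monoʳ-≤ A {{ℕ.>-nonZero 1≤A}} nd≤mk)
      (ℕ.≤-reflexive (sym (ℕ.^-*-assoc A (suc m) k)))))

-- x^i ≤ c^(k i) < c^m ≤ a^s; the strictness comes from the exponents.
belowPow : ∀ {c a x s} i k m → 0ℚ ℚ.≤ x → 1ℚ ℚ.< c → c ℚ.≤ a → x ℚ.≤ c ^ℚ k → k ℕ.* i ℕ.< m →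
  ιℕ m ℚ.≤ s → BelowPow (x ^ℚ i) a s
belowPow {s = s@(mkℚ -[1+ _ ] _ _)} i k m _ _ _ _ _ m≤s = contradiction (ℚ.negative⁻¹ s)
  (≤⇒≯ (ℚ.≤-trans (0≤ιℕ m) m≤s))
belowPow {c} {a} {x} {s@(mkℚ (+ n) d-1 _)} i k m 0≤x 1<c c≤a x≤c^k ki<m m≤s = 0<a , inj₂ (begin-strict
  (x ^ℚ i) ^ℚ d ℚ.* 1ℚ ≡⟨ ℚ.*-identityʳ _ ⟩
  (x ^ℚ i) ^ℚ d        ≤⟨ ^-monoˡ-≤ d (0≤^ i 0≤x) (^-monoˡ-≤ i 0≤x x≤c^k) ⟩
  ((c ^ℚ k) ^ℚ i) ^ℚ d ≡⟨ trans (cong (_^ℚ d) (^-assocʳ c k i)) (^-assocʳ c (k ℕ.* i) d) ⟩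
  c ^ℚ (k ℕ.* i ℕ.* d) <⟨ ^-monoʳ-< 1<c (ℕ.<-≤-trans (ℕ.*-monoˡ-< d ki<m) md≤n) ⟩
  c ^ℚ n               ≤⟨ ^-monoˡ-≤ n (ℚ.<⇒≤ 0<c) c≤a ⟩
  a ^ℚ n ∎)
  where
  open ℚ.≤-Reasoning
  d = suc d-1
  0<c = ℚ.<-trans 0<1 1<c
  0<a = ℚ.<-≤-trans 0<c c≤a
  md≤n : m ℕ.* d ℕ.≤ n
  md≤n = ℕ.≮⇒≥ λ lt → ≤⇒≯ (begin
    ιℕ (m ℕ.* d) ≡⟨ ιℕ-* m d ⟩
    ιℕ m ℚ.* ιℕ d ≤⟨ *-monoˡ-≤ (0≤ιℕ d) m≤s ⟩
    s ℚ.* ιℕ d ≡⟨ x≡↥/↧ s ⟩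
    ιℕ n ∎) (ιℕ-mono-< {n} {m ℕ.* d} lt)

-- The sign of d decides which corner helps. For d ≥ 0, b^d < s with b ≥ 1 already gives s > 1. For
-- d < 0, a < q and -d < 2 turn a^d < s into 1 < s q².
aboveInverseSquare : ∀ {s a b q d} → 1 ℕ.≤ q → a ℚ.< ιℕ q → ιℕ q ℚ.< b → ℚ.- ιℕ 2 ℚ.< d →
  AbovePow s a d → AbovePow s b d → 0ℚ ℚ.< s × 1ℚ ℚ.< s ℚ.* ιℕ (q ℕ.* q)
aboveInverseSquare {s} {a} {b} {q} {d@(mkℚ (+ n) f-1 _)} 1≤q a<q q<b -2<d _ (_ , 0<s , b^<) = 0<s ,
  (begin-strict
  1ℚ <⟨ 1<^⇒1< (suc f-1) (ℚ.<⇒≤ 0<s) (ℚ.≤-<-trans (1≤^ n (ℚ.≤-trans 1≤ιq (ℚ.<⇒≤ q<b)))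
    (subst (b ^ℚ n ℚ.<_) (ℚ.*-identityʳ (s ^ℚ suc f-1)) b^<)) ⟩
  s ≡⟨ sym (ℚ.*-identityʳ s) ⟩
  s ℚ.* 1ℚ ≤⟨ *-monoʳ-≤ (ℚ.<⇒≤ 0<s) (ιℕ-mono-≤ {1} {q ℕ.* q} (ℕ.*-mono-≤ {1} {q} 1≤q 1≤q)) ⟩
  s ℚ.* ιℕ (q ℕ.* q) ∎)
  where
  open ℚ.≤-Reasoning
  1≤ιq : 1ℚ ℚ.≤ ιℕ q
  1≤ιq = ιℕ-mono-≤ {1} {q} 1≤q
aboveInverseSquare {s} {a} {b} {q} {d@(mkℚ -[1+ n ] f-1 _)} 1≤q a<q q<b -2<d (0<a , 0<s , 1<) _ =
  0<s , 1<^⇒1< f (0≤* (ℚ.<⇒≤ 0<s) (0≤ιℕ (q ℕ.* q))) (begin-strict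
  1ℚ <⟨ 1< ⟩
  s ^ℚ f ℚ.* a ^ℚ suc n ≤⟨ *-monoʳ-≤ (0≤^ f (ℚ.<⇒≤ 0<s))
    (ℚ.≤-trans (^-monoˡ-≤ (suc n) (ℚ.<⇒≤ 0<a) (ℚ.<⇒≤ a<q)) (^-monoʳ-≤ (ιℕ-mono-≤ {1} {q} 1≤q) n<2f)) ⟩
  s ^ℚ f ℚ.* ιℕ q ^ℚ (2 ℕ.* f) ≡⟨ cong (s ^ℚ f ℚ.*_)
    (trans (sym (^-assocʳ (ιℕ q) 2 f)) (cong (_^ℚ f)
    (trans (cong (ιℕ q ℚ.*_) (ℚ.*-identityʳ (ιℕ q))) (sym (ιℕ-* q q))))) ⟩
  s ^ℚ f ℚ.* ιℕ (q ℕ.* q) ^ℚ f ≡⟨ sym (^-distrib-* s (ιℕ (q ℕ.* q)) f) ⟩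
  (s ℚ.* ιℕ (q ℕ.* q)) ^ℚ f ∎)
  where
  open ℚ.≤-Reasoning
  f = suc f-1
  n<2f : suc n ℕ.≤ 2 ℕ.* f
  n<2f = ℕ.<⇒≤ (ιℕ-cancel-< {suc n} {2 ℕ.* f} (begin-strict
    ιℕ (suc n) ≡⟨ sym (trans (cong ℚ.-_ (x≡↥/↧ d)) (sym (ι-neg -[1+ n ]))) ⟩
    ℚ.- (d ℚ.* ιℕ f) ≡⟨ ℚ.neg-distribˡ-* d (ιℕ f) ⟩
    (ℚ.- d) ℚ.* ιℕ f <⟨ *-monoˡ-< (ιℕ-mono-< {0} {f} (ℕ.s≤s ℕ.z≤n)) (ℚ.neg-antimono-< -2<d) ⟩
    ιℕ 2 ℚ.* ιℕ f ≡⟨ sym (ιℕ-* 2 f) ⟩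
    ιℕ (2 ℕ.* f) ∎))

-- With h = 1/k < ε < u the box is [q - 1, q + 1] × [-(3 + u), -(2 + h)]. Its worst corner is (q -
-- 1, -(2 + h)), where the last hypothesis says M < (q - 1)^(2 + h).
upper-power : ∀ {ε r} k M q .{{_ : ℕ.NonZero k}} .{{_ : ℕ.NonZero M}} → IsReal ε →
  lower ε r → + 1 ℚ./ k ℚ.< r → 2 ℕ.≤ q → M ℕ.^ k ℕ.< (q ℕ.∸ 1) ℕ.^ (2 ℕ.* k ℕ.+ 1) →
  upper (fromℕ q ^ (- (fromℕ 2 + ε))) (+ 1 ℚ./ M)
upper-power {ε} {r} k M q εR r<ε h<r 2≤q M^< =
  ιℕ (q ℕ.∸ 1) , ιℕ (q ℕ.+ 1) , c , d ,
    ( ιℕ-mono-< {q ℕ.∸ 1} {q} (ℕ.≤-reflexive (ℕ.m+[n∸m]≡n {1} {q} 1≤q)) , ιℕ-mono-< {q} {q ℕ.+ 1}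
      (ℕ.≤-reflexive (ℕ.+-comm 1 q))
    , (ιℕ 3 , u , ιℕ-mono-< {2} {3} ℕ.≤-refl , ε<u , sym (neg-neg (ιℕ 3 ℚ.+ u)))
    -- A sum of cuts needs summands strictly below 2 and ε, so 2 + h is split as (2 - (r - h)) + r.
    , (ιℕ 2 ℚ.+ (h ℚ.- r) , r , subst (ιℕ 2 ℚ.+ (h ℚ.- r) ℚ.<_) (ℚ.+-identityʳ (ιℕ 2))
         (ℚ.+-monoʳ-< (ιℕ 2) (subst (h ℚ.- r ℚ.<_) (ℚ.+-inverseʳ r) (ℚ.+-monoˡ-< (ℚ.- r) h<r))) , r<ε
       , solve 3 (λ t h r → (t :+ (h :- r)) :+ r := :- (:- (t :+ h))) refl (ιℕ 2) h r) )
  , above (ιℕ (q ℕ.∸ 1)) c ℚ.≤-refl 2+h≤-c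
  , above (ιℕ (q ℕ.∸ 1)) d ℚ.≤-refl 2+h≤-d
  , above (ιℕ (q ℕ.+ 1)) c q-1≤q+1 2+h≤-c
  , above (ιℕ (q ℕ.+ 1)) d q-1≤q+1 2+h≤-d
  where
  h = + 1 ℚ./ k
  u = proj₁ (IsReal.upper-inhabited εR)
  ε<u = proj₂ (IsReal.upper-inhabited εR)
  c = ℚ.- (ιℕ 3 ℚ.+ u)
  d = ℚ.- (ιℕ 2 ℚ.+ h)
  neg-neg : ∀ x → ℚ.- (ℚ.- x) ≡ x
  neg-neg = solve 1 (λ x → :- (:- x) := x) refl
  2+h≤-c : ιℕ 2 ℚ.+ h ℚ.≤ ℚ.- c
  2+h≤-c = subst (ιℕ 2 ℚ.+ h ℚ.≤_) (sym (neg-neg (ιℕ 3 ℚ.+ u)))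
    (ℚ.+-mono-≤ (ιℕ-mono-≤ {2} {3} (ℕ.n≤1+n 2)) (ℚ.<⇒≤ (ℚ.<-trans h<r (lower<upper εR r<ε ε<u))))
  2+h≤-d : ιℕ 2 ℚ.+ h ℚ.≤ ℚ.- d
  2+h≤-d = ℚ.≤-reflexive (sym (neg-neg (ιℕ 2 ℚ.+ h)))
  1≤q : 1 ℕ.≤ q
  1≤q = ℕ.≤-trans (ℕ.n≤1+n 1) 2≤q
  q-1≤q+1 : ιℕ (q ℕ.∸ 1) ℚ.≤ ιℕ (q ℕ.+ 1)
  q-1≤q+1 = ιℕ-mono-≤ {q ℕ.∸ 1} {q ℕ.+ 1} (ℕ.≤-trans (ℕ.m∸n≤m q 1) (ℕ.m≤m+n q 1))
  above : ∀ a s → ιℕ (q ℕ.∸ 1) ℚ.≤ a → ιℕ 2 ℚ.+ h ℚ.≤ ℚ.- s → AbovePow (+ 1 ℚ./ M) a s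
  above a s q-1≤a 2+h≤-s = abovePow (2 ℕ.* k ℕ.+ 1) M (q ℕ.∸ 1) k {a} {s} (ℕ.∸-monoˡ-≤ 1 2≤q) M^< q-1≤a
    (ℚ.<-≤-trans (ℚ.+-mono-< {0ℚ} {ιℕ 2} {0ℚ} {h} (ιℕ-mono-< {0} {2} (ℕ.s≤s ℕ.z≤n)) (0<1/ k)) 2+h≤-s)
    (begin
      ιℕ (2 ℕ.* k ℕ.+ 1) ≡⟨ trans (ιℕ-+ (2 ℕ.* k) 1) (cong (ℚ._+ 1ℚ) (ιℕ-* 2 k)) ⟩
      ιℕ 2 ℚ.* ιℕ k ℚ.+ 1ℚ ≡⟨ cong (ιℕ 2 ℚ.* ιℕ k ℚ.+_) (sym (/-*-cancel (+ 1) k)) ⟩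
      ιℕ 2 ℚ.* ιℕ k ℚ.+ h ℚ.* ιℕ k ≡⟨ sym (ℚ.*-distribʳ-+ (ιℕ k) (ιℕ 2) h) ⟩
      (ιℕ 2 ℚ.+ h) ℚ.* ιℕ k ≤⟨ *-monoˡ-≤ (0≤ιℕ k) 2+h≤-s ⟩
      (ℚ.- s) ℚ.* ιℕ k ∎)
    where open ℚ.≤-Reasoning

-- With ε = 2 - ρ and y < ρ, the exponent -(y + ε) exceeds -2, so a bound s above that power of q
-- also lies above q^(-2).
upper-power⁻¹ : ∀ {y ρ s} q → IsReal y → upper y ρ → 1 ℕ.≤ q →
  upper (fromℕ q ^ (- (y + fromℚ (ιℕ 2 ℚ.- ρ)))) s → 1ℚ ℚ.< s ℚ.* ιℕ (q ℕ.* q)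
upper-power⁻¹ {y} {ρ} {s} q yR y<ρ 1≤q (a , c , _ , d ,
  (a<q , q<c , _ , (s′ , t′ , s′<y , t′<ε , s′+t′≡-d)) , (_ , ad , _ , cd)) =
  proj₂ (aboveInverseSquare {s} {a} {c} {q} {d} 1≤q a<q q<c -2<d ad cd)
  where
  -2<d : ℚ.- ιℕ 2 ℚ.< d
  -2<d = 0<-⇒< (subst (0ℚ ℚ.<_)
    (trans (solve 4 (λ s t r w → (r :- s) :+ ((w :- r) :- t) := :- (s :+ t) :- :- w) refl s′ t′ ρ
      (ιℕ 2))
      (cong (ℚ._- (ℚ.- ιℕ 2)) (trans (cong ℚ.-_ s′+t′≡-d) (solve 1 (λ d → :- (:- d) := d) refl d))))
    (ℚ.+-mono-< (<⇒0<- (lower<upper yR s′<y y<ρ)) (<⇒0<- t′<ε)))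

-- Bernoulli gives (1 + 1/k)^k ≥ 2, hence 2^i ≤ (1 + 1/k)^(k i) < (1 + 1/k)^(q - 1). Thus 2^i lies
-- below (1 + ε)^q and above M.
upper-recip-power : ∀ {ε r} k i M q .{{_ : ℕ.NonZero k}} .{{_ : ℕ.NonZero M}} → IsReal ε →
  lower ε r → + 1 ℚ./ k ℚ.< r → 1 ℕ.≤ q → k ℕ.* i ℕ.< q ℕ.∸ 1 → M ℕ.< 2 ℕ.^ i →
  upper (recip ((fromℕ 1 + ε) ^ fromℕ q)) (+ 1 ℚ./ M)
upper-recip-power {ε} {r} k i M q εR r<ε h<r 1≤q ki<q-1 M< =
  ιℕ 2 ^ℚ i , 0<^ i (ιℕ-mono-< {0} {2} (ℕ.s≤s ℕ.z≤n)) ,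
    (a , c , ιℕ (q ℕ.∸ 1) , ιℕ (q ℕ.+ 1) ,
      ( (1ℚ ℚ.+ (h ℚ.- r) , r , subst (1ℚ ℚ.+ (h ℚ.- r) ℚ.<_) (ℚ.+-identityʳ 1ℚ)
           (ℚ.+-monoʳ-< 1ℚ (subst (h ℚ.- r ℚ.<_) (ℚ.+-inverseʳ r) (ℚ.+-monoˡ-< (ℚ.- r) h<r))) , r<ε
         , solve 2 (λ h r → (con 1ℚ :+ (h :- r)) :+ r := con 1ℚ :+ h) refl h r)
      , (ιℕ 2 , u , ιℕ-mono-< {1} {2} ℕ.≤-refl , ε<u , refl)
      , ιℕ-mono-< {q ℕ.∸ 1} {q} (ℕ.≤-reflexive (ℕ.m+[n∸m]≡n {1} {q} 1≤q)) , ιℕ-mono-< {q} {q ℕ.+ 1}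
        (ℕ.≤-reflexive (ℕ.+-comm 1 q)) )
      , below a (ιℕ (q ℕ.∸ 1)) ℚ.≤-refl ℚ.≤-refl
      , below a (ιℕ (q ℕ.+ 1)) ℚ.≤-refl q-1≤q+1
      , below c (ιℕ (q ℕ.∸ 1)) a≤c ℚ.≤-refl
      , below c (ιℕ (q ℕ.+ 1)) a≤c q-1≤q+1) ,
    subst₂ ℚ._<_ (/-*-cancel (+ 1) M) (cong (+ 1 ℚ./ M ℚ.*_) (ιℕ-^ 2 i))
      (*-monoʳ-< (0<1/ M) (ιℕ-mono-< {M} {2 ℕ.^ i} M<))
  where
  h = + 1 ℚ./ k
  u = proj₁ (IsReal.upper-inhabited εR)
  ε<u = proj₂ (IsReal.upper-inhabited εR)
  a = 1ℚ ℚ.+ h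
  1<a : 1ℚ ℚ.< a
  1<a = subst (ℚ._< a) (ℚ.+-identityʳ 1ℚ) (ℚ.+-monoʳ-< 1ℚ (0<1/ k))
  2≤a^k : ιℕ 2 ℚ.≤ a ^ℚ k
  2≤a^k = subst (ℚ._≤ a ^ℚ k) (cong (1ℚ ℚ.+_) (trans (ℚ.*-comm (ιℕ k) h) (/-*-cancel (+ 1) k)))
    (bernoulli k (ℚ.<⇒≤ (0<1/ k)))
  c = ιℕ 2 ℚ.+ u
  a≤c : a ℚ.≤ c
  a≤c = ℚ.+-mono-≤ {1ℚ} {ιℕ 2} {h} {u} (ιℕ-mono-≤ {1} {2} (ℕ.n≤1+n 1))
    (ℚ.<⇒≤ (ℚ.<-trans h<r (lower<upper εR r<ε ε<u)))
  q-1≤q+1 : ιℕ (q ℕ.∸ 1) ℚ.≤ ιℕ (q ℕ.+ 1)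
  q-1≤q+1 = ιℕ-mono-≤ {q ℕ.∸ 1} {q ℕ.+ 1} (ℕ.≤-trans (ℕ.m∸n≤m q 1) (ℕ.m≤m+n q 1))
  below : ∀ a′ s → a ℚ.≤ a′ → ιℕ (q ℕ.∸ 1) ℚ.≤ s → BelowPow (ιℕ 2 ^ℚ i) a′ s
  below a′ s a≤a′ q-1≤s = belowPow {a} {a′} {ιℕ 2} {s} i k (q ℕ.∸ 1) (0≤ιℕ 2) 1<a a≤a′ 2≤a^k ki<q-1
    q-1≤s

-- Continued fractions

-- If u = 0, or if u and v have opposite signs, nothing cancels: the absolute value is c∣u∣ + a∣v∣.
-- With v = 0 and u = 0 this is 0, and with v ≠ 0 it is at least a; neither can equal q.
signs-agree : ∀ (c a q : ℕ) (u v : ℤ) → 0 ℕ.< q → q ℕ.< a →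
  ℤ.∣ + c ℤ.* u ℤ.- + a ℤ.* v ∣ ≡ q →
  (+ 1 ℤ.≤ u × + 0 ℤ.≤ v) ⊎ (+ 1 ℤ.≤ ℤ.- u × + 0 ℤ.≤ ℤ.- v)
signs-agree c a q (+ suc u) (+ v) _ _ _ = inj₁ (ℤ.+≤+ (ℕ.s≤s ℕ.z≤n) , ℤ.+≤+ ℕ.z≤n)
signs-agree c a q -[1+ u ] (+ zero) _ _ _ = inj₂ (ℤ.+≤+ (ℕ.s≤s ℕ.z≤n) , ℤ.+≤+ ℕ.z≤n)
signs-agree c a q -[1+ u ] -[1+ v ] _ _ _ = inj₂ (ℤ.+≤+ (ℕ.s≤s ℕ.z≤n) , ℤ.+≤+ ℕ.z≤n)
signs-agree c a q (+ zero) (+ zero) 0<q _ eq = contradiction (subst (0 ℕ.<_) (sym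
  (trans (sym (cong ℤ.∣_∣ {+ c ℤ.* + 0 ℤ.- + a ℤ.* + 0} {+ 0}
    (ℤS.solve 2 (λ c a → c ℤS.:* ℤS.con (+ 0) ℤS.:- a ℤS.:* ℤS.con (+ 0) ℤS.:= ℤS.con (+ 0)) refl (+ c)
    (+ a)))) eq)) 0<q) λ ()
signs-agree c a q (+ zero) (+ suc v) _ q<a eq = contradiction q<a
  (ℕ.≤⇒≯ (subst (a ℕ.≤_) eq (ℕ.≤-trans (ℕ.m≤m*n a (suc v)) (ℕ.≤-reflexive (sym (trans
  (cong ℤ.∣_∣ {+ c ℤ.* + 0 ℤ.- + a ℤ.* + suc v} {ℤ.- (+ a ℤ.* + suc v)}
    (ℤS.solve 3 (λ c a v → c ℤS.:* ℤS.con (+ 0) ℤS.:- a ℤS.:* v ℤS.:= ℤS.:- (a ℤS.:* v)) refl (+ c)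
    (+ a) (+ suc v)))
  (trans (ℤ.∣-i∣≡∣i∣ (+ a ℤ.* + suc v)) (ℤ.abs-* (+ a) (+ suc v)))))))))
signs-agree c a q (+ u) -[1+ v ] _ q<a eq = contradiction q<a
  (ℕ.≤⇒≯ (subst (a ℕ.≤_) eq (ℕ.≤-trans (ℕ.≤-trans (ℕ.m≤m*n a (suc v)) (ℕ.m≤n+m _ (c ℕ.* u)))
  (ℕ.≤-reflexive (sym
  (cong ℤ.∣_∣ {+ c ℤ.* + u ℤ.- + a ℤ.* -[1+ v ]} {+ (c ℕ.* u ℕ.+ a ℕ.* suc v)}
    (trans (ℤS.solve 4 (λ c u a v → c ℤS.:* u ℤS.:- a ℤS.:* ℤS.:- v ℤS.:= c ℤS.:* u ℤS.:+ a ℤS.:* v)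
    refl (+ c) (+ u) (+ a) (+ suc v))
    (sym (cong₂ ℤ._+_ (ℤ.pos-* c u) (ℤ.pos-* a (suc v)))))))))))
signs-agree c a q -[1+ u ] (+ suc v) _ q<a eq = contradiction q<a
  (ℕ.≤⇒≯ (subst (a ℕ.≤_) eq (ℕ.≤-trans (ℕ.≤-trans (ℕ.m≤m*n a (suc v)) (ℕ.m≤n+m _ (c ℕ.* suc u)))
  (ℕ.≤-reflexive (sym
  (trans (cong ℤ.∣_∣ {+ c ℤ.* -[1+ u ] ℤ.- + a ℤ.* + suc v} {ℤ.- + (c ℕ.* suc u ℕ.+ a ℕ.* suc v)}
    (trans (ℤS.solve 4 (λ c u a v → c ℤS.:* (ℤS.:- u) ℤS.:- a ℤS.:* v ℤS.:= ℤS.:-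
    (c ℤS.:* u ℤS.:+ a ℤS.:* v)) refl (+ c) (+ suc u) (+ a) (+ suc v))
    (cong ℤ.-_ (sym (cong₂ ℤ._+_ (ℤ.pos-* c (suc u)) (ℤ.pos-* a (suc v)))))))
      (ℤ.∣-i∣≡∣i∣ (+ (c ℕ.* suc u ℕ.+ a ℕ.* suc v)))))))))

pos≡+∣∣ : ∀ i → ℤ.Positive i → i ≡ + ℤ.∣ i ∣
pos≡+∣∣ (+ suc n) _ = refl

module ContinuedFraction (b : ℕ → ℤ) (b-pos : ∀ n → ℤ.Positive (b (suc n))) where

  B : ℕ → ℕ
  B n = ℤ.∣ b (suc n) ∣

  b≡B : ∀ n → b (suc n) ≡ + B n
  b≡B n = pos≡+∣∣ (b (suc n)) (b-pos n)

  1≤B : ∀ n → 1 ℕ.≤ B n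
  1≤B n with b (suc n) | b-pos n
  ... | + suc m | _ = ℕ.s≤s ℕ.z≤n

  -- Indices are shifted by one, to include p₋₁ = 1 and q₋₁ = 0: pₙ = P (suc n) and qₙ = Q (suc n).
  P : ℕ → ℤ
  P 0             = + 1
  P 1             = b 0
  P (suc (suc n)) = b (suc n) ℤ.* P (suc n) ℤ.+ P n

  Q : ℕ → ℕ
  Q 0             = 0
  Q 1             = 1
  Q (suc (suc n)) = B n ℕ.* Q (suc n) ℕ.+ Q n

  Q-rec : ∀ n → + Q (suc (suc n)) ≡ b (suc n) ℤ.* + Q (suc n) ℤ.+ + Q n
  Q-rec n = cong (ℤ._+ + Q n) (trans (ℤ.pos-* (B n) (Q (suc n)))
    (cong (ℤ._* + Q (suc n)) (sym (b≡B n))))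

  Q≤Q-suc : ∀ n → Q n ℕ.≤ Q (suc n)
  Q≤Q-suc zero    = ℕ.z≤n
  Q≤Q-suc (suc n) = ℕ.≤-trans (ℕ.m≤n*m (Q (suc n)) (B n) {{ℕ.>-nonZero (1≤B n)}}) (ℕ.m≤m+n _ (Q n))

  fib≤Q : ∀ n → fib n ℕ.≤ Q (suc n)
  fib≤Q 0             = ℕ.≤-refl
  fib≤Q 1             = ℕ.≤-trans (ℕ.≤-trans (1≤B 0) (ℕ.≤-reflexive (sym (ℕ.*-identityʳ (B 0)))))
    (ℕ.m≤m+n _ 0)
  fib≤Q (suc (suc n)) = ℕ.+-mono-≤ (ℕ.≤-trans (fib≤Q (suc n))
    (ℕ.m≤n*m (Q (suc (suc n))) (B (suc n)) {{ℕ.>-nonZero (1≤B (suc n))}})) (fib≤Q n)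

  Q≤2BQ : ∀ n → Q (suc (suc n)) ℕ.≤ 2 ℕ.* (B n ℕ.* Q (suc n))
  Q≤2BQ n = ℕ.+-monoʳ-≤ (B n ℕ.* Q (suc n)) (ℕ.≤-trans (Q≤Q-suc n)
    (ℕ.≤-trans (ℕ.m≤n*m (Q (suc n)) (B n) {{ℕ.>-nonZero (1≤B n)}}) (ℕ.m≤m+n _ 0)))

  determinant : ∀ n → ℤ.∣ P (suc n) ℤ.* + Q n ℤ.- P n ℤ.* + Q (suc n) ∣ ≡ 1
  determinant zero    = cong (λ z → ℤ.∣ z ℤ.+ -[1+ 0 ] ∣) (ℤ.*-zeroʳ (b 0))
  determinant (suc n) = trans (cong ℤ.∣_∣ eq)
    (trans (ℤ.∣-i∣≡∣i∣ (P (suc n) ℤ.* + Q n ℤ.- P n ℤ.* + Q (suc n))) (determinant n))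
    where
    eq : P (suc (suc n)) ℤ.* + Q (suc n) ℤ.- P (suc n) ℤ.* + Q (suc (suc n)) ≡
      ℤ.- (P (suc n) ℤ.* + Q n ℤ.- P n ℤ.* + Q (suc n))
    eq = trans (cong (λ z → P (suc (suc n)) ℤ.* + Q (suc n) ℤ.- P (suc n) ℤ.* z) (Q-rec n))
      (ℤS.solve 5 (λ c p p′ q q′ → (c ℤS.:* p ℤS.:+ p′) ℤS.:* q ℤS.:- p ℤS.:* (c ℤS.:* q ℤS.:+ q′) ℤS.:=
        ℤS.:- (p ℤS.:* q′ ℤS.:- p′ ℤS.:* q)) refl (b (suc n)) (P (suc n)) (P n) (+ Q (suc n)) (+ Q n))

  t : ℕ → ℕ → ℚ
  t = tail b b-pos

  0<t : ∀ k n → 0ℚ ℚ.< t k n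
  0<t k n = ℚ.positive⁻¹ (t k n) {{tail-pos b b-pos k n}}

  1≤b : ∀ n → 1ℚ ℚ.≤ ι (b (suc n))
  1≤b n rewrite b≡B n = ιℕ-mono-≤ {1} {B n} (1≤B n)

  1/t : ℕ → ℕ → ℚ
  1/t k n = (ℚ.1/ t k n) {{ℚ.pos⇒nonZero (t k n) {{tail-pos b b-pos k n}}}}

  t*1/t : ∀ k n → t k n ℚ.* 1/t k n ≡ 1ℚ
  t*1/t k n = ℚ.*-inverseʳ (t k n) {{ℚ.pos⇒nonZero (t k n) {{tail-pos b b-pos k n}}}}

  0<1/t : ∀ k n → 0ℚ ℚ.< 1/t k n
  0<1/t k n = ℚ.positive⁻¹ (1/t k n) {{ℚ.1/pos⇒pos (t k n) {{tail-pos b b-pos k n}}}}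

  1≤t : ∀ k n → 1ℚ ℚ.≤ t k n
  1≤t k zero    = 1≤b k
  1≤t k (suc n) = ℚ.≤-trans (1≤b k) (ℚ.≤-trans (ℚ.≤-reflexive (sym (ℚ.+-identityʳ _)))
    (ℚ.+-monoʳ-≤ (ι (b (suc k))) (ℚ.<⇒≤ (0<1/t (suc k) n))))

  -- [b₀; …, bₖ, t] = (pₖ t + pₖ₋₁) / (qₖ t + qₖ₋₁)
  convergent-tail : ∀ k n → convergent b b-pos (k ℕ.+ suc n) ℚ.* (ιℕ (Q (suc k)) ℚ.* t k n ℚ.+ ιℕ (Q k)) ≡
    ι (P (suc k)) ℚ.* t k n ℚ.+ ι (P k)
  convergent-tail zero n = trans
    (solve 3 (λ b t i → (b :+ i) :* (con 1ℚ :* t :+ con 0ℚ) := b :* t :+ t :* i) refl (ι (b 0)) (t 0 n)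
      (1/t 0 n))
    (cong (ι (b 0) ℚ.* t 0 n ℚ.+_) (t*1/t 0 n))
  convergent-tail (suc k) n = begin
    x ℚ.* (ιℕ (Q (suc (suc k))) ℚ.* t′ ℚ.+ ιℕ (Q (suc k)))
      ≡⟨ cong (λ z → x ℚ.* (z ℚ.* t′ ℚ.+ ιℕ (Q (suc k))))
        (trans (cong ι (Q-rec k)) (ι-rec (+ Q (suc k)) (+ Q k))) ⟩
    x ℚ.* ((β ℚ.* ιℕ (Q (suc k)) ℚ.+ ιℕ (Q k)) ℚ.* t′ ℚ.+ ιℕ (Q (suc k)))
      -- Inserting t′ * (1 / t′) lets t′ be factored out; what remains contains β + 1 / t′, which is
      -- `t k (suc n)`, so the identity at k applies.
      ≡⟨ cong (λ z → x ℚ.* ((β ℚ.* ιℕ (Q (suc k)) ℚ.+ ιℕ (Q k)) ℚ.* t′ ℚ.+ z)) (one (ιℕ (Q (suc k)))) ⟩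
    x ℚ.* ((β ℚ.* ιℕ (Q (suc k)) ℚ.+ ιℕ (Q k)) ℚ.* t′ ℚ.+ ιℕ (Q (suc k)) ℚ.* (t′ ℚ.* i))
      ≡⟨ solve 6 (λ x β q q′ t i → x :* ((β :* q :+ q′) :* t :+ q :* (t :* i)) := x :*
        (q :* (β :+ i) :+ q′) :* t) refl x β (ιℕ (Q (suc k))) (ιℕ (Q k)) t′ i ⟩
    x ℚ.* (ιℕ (Q (suc k)) ℚ.* (β ℚ.+ i) ℚ.+ ιℕ (Q k)) ℚ.* t′
      ≡⟨ cong (ℚ._* t′) (trans (cong (λ z → convergent b b-pos z ℚ.*
        (ιℕ (Q (suc k)) ℚ.* (β ℚ.+ i) ℚ.+ ιℕ (Q k))) (sym (ℕ.+-suc k (suc n))))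
        (convergent-tail k (suc n))) ⟩
    (ι (P (suc k)) ℚ.* (β ℚ.+ i) ℚ.+ ι (P k)) ℚ.* t′
      ≡⟨ solve 5 (λ β q q′ t i → (q :* (β :+ i) :+ q′) :* t := (β :* q :+ q′) :* t :+ q :* (t :* i))
        refl β (ι (P (suc k))) (ι (P k)) t′ i ⟩
    (β ℚ.* ι (P (suc k)) ℚ.+ ι (P k)) ℚ.* t′ ℚ.+ ι (P (suc k)) ℚ.* (t′ ℚ.* i)
      ≡⟨ cong₂ (λ y z → y ℚ.* t′ ℚ.+ z) (sym (ι-rec (P (suc k)) (P k))) (sym (one (ι (P (suc k))))) ⟩
    ι (P (suc (suc k))) ℚ.* t′ ℚ.+ ι (P (suc k)) ∎
    where
    open ≡-Reasoning
    x = convergent b b-pos (suc k ℕ.+ suc n)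
    t′ = t (suc k) n
    i = 1/t (suc k) n
    β = ι (b (suc k))
    ι-rec : ∀ i j → ι (b (suc k) ℤ.* i ℤ.+ j) ≡ β ℚ.* ι i ℚ.+ ι j
    ι-rec i j = trans (ι-+ (b (suc k) ℤ.* i) j) (cong (ℚ._+ ι j) (ι-* (b (suc k)) i))
    one : ∀ z → z ≡ z ℚ.* (t′ ℚ.* i)
    one z = sym (trans (cong (z ℚ.*_) (t*1/t (suc k) n)) (ℚ.*-identityʳ z))

  private
    x : ℕ → ℕ → ℚ
    x k n = convergent b b-pos (k ℕ.+ suc n)

    d : ℕ → ℕ → ℚ
    d k n = ιℕ (Q (suc k)) ℚ.* t k n ℚ.+ ιℕ (Q k)

  Q≤d : ∀ k n → ιℕ (Q (suc k)) ℚ.≤ d k n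
  Q≤d k n = subst (ℚ._≤ d k n) (ℚ.+-identityʳ (ιℕ (Q (suc k)))) (ℚ.+-mono-≤
    (subst (ℚ._≤ ιℕ (Q (suc k)) ℚ.* t k n) (ℚ.*-identityʳ (ιℕ (Q (suc k))))
      (*-monoʳ-≤ (0≤ιℕ (Q (suc k))) (1≤t k n))) (0≤ιℕ (Q k)))

  1≤Q : ∀ k → 1 ℕ.≤ Q (suc k)
  1≤Q zero    = ℕ.≤-refl
  1≤Q (suc k) = ℕ.≤-trans (1≤Q k) (Q≤Q-suc (suc k))

  0<d : ∀ k n → 0ℚ ℚ.< d k n
  0<d k n = ℚ.<-≤-trans (ιℕ-mono-< {0} {Q (suc k)} (1≤Q k)) (Q≤d k n)

  error : ∀ k n p q → (ιℕ q ℚ.* x k n ℚ.- ι p) ℚ.* d k n ≡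
    ι (+ q ℤ.* P (suc k) ℤ.- p ℤ.* + Q (suc k)) ℚ.* t k n ℚ.+ ι (+ q ℤ.* P k ℤ.- p ℤ.* + Q k)
  error k n p q = begin
    (ιℕ q ℚ.* x k n ℚ.- ι p) ℚ.* d k n
      ≡⟨ solve 4 (λ q x p d → (q :* x :- p) :* d := q :* (x :* d) :- p :* d) refl (ιℕ q) (x k n) (ι p)
        (d k n) ⟩
    ιℕ q ℚ.* (x k n ℚ.* d k n) ℚ.- ι p ℚ.* d k n
      ≡⟨ cong (λ z → ιℕ q ℚ.* z ℚ.- ι p ℚ.* d k n) (convergent-tail k n) ⟩
    ιℕ q ℚ.* (ι (P (suc k)) ℚ.* t k n ℚ.+ ι (P k)) ℚ.- ι p ℚ.* d k n
      ≡⟨ solve 7 (λ q p P₁ P₀ Q₁ Q₀ t → q :* (P₁ :* t :+ P₀) :- p :* (Q₁ :* t :+ Q₀) :=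
        (q :* P₁ :- p :* Q₁) :* t :+ (q :* P₀ :- p :* Q₀)) refl
         (ιℕ q) (ι p) (ι (P (suc k))) (ι (P k)) (ιℕ (Q (suc k))) (ιℕ (Q k)) (t k n) ⟩
    (ιℕ q ℚ.* ι (P (suc k)) ℚ.- ι p ℚ.* ιℕ (Q (suc k))) ℚ.* t k n ℚ.+
      (ιℕ q ℚ.* ι (P k) ℚ.- ι p ℚ.* ιℕ (Q k))
      ≡⟨ cong₂ (λ y z → y ℚ.* t k n ℚ.+ z) (cast (P (suc k)) (Q (suc k))) (cast (P k) (Q k)) ⟩
    _ ∎
    where
    open ≡-Reasoning
    cast : ∀ i j → ιℕ q ℚ.* ι i ℚ.- ι p ℚ.* ιℕ j ≡ ι (+ q ℤ.* i ℤ.- p ℤ.* + j)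
    cast i j = sym (trans (ι-+ (+ q ℤ.* i) (ℤ.- (p ℤ.* + j))) (cong₂ ℚ._+_ (ι-* (+ q) i)
      (trans (ι-neg (p ℤ.* + j)) (cong ℚ.-_ (ι-* p (+ j))))))

  private
    -- As t ≥ 1, the denominator qₖ t + qₖ₋₁ is at most 2 qₖ t, while u t + v is at least t.
    error-≥ : ∀ k n y u v → + 1 ℤ.≤ u → + 0 ℤ.≤ v → y ℚ.* d k n ≡ ι u ℚ.* t k n ℚ.+ ι v →
      1ℚ ℚ.≤ ιℕ (2 ℕ.* Q (suc k)) ℚ.* y
    error-≥ k n y u v 1≤u 0≤v eq = *-cancelʳ-≤ (0<d k n) (begin
      1ℚ ℚ.* d k n ≡⟨ ℚ.*-identityˡ (d k n) ⟩
      d k n ≤⟨ ℚ.+-monoʳ-≤ (q ℚ.* t k n) (ℚ.≤-trans (ιℕ-mono-≤ {Q k} {Q (suc k)} (Q≤Q-suc k))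
               (subst (ℚ._≤ q ℚ.* t k n) (ℚ.*-identityʳ q) (*-monoʳ-≤ (0≤ιℕ (Q (suc k))) (1≤t k n)))) ⟩
      q ℚ.* t k n ℚ.+ q ℚ.* t k n ≡⟨ solve 2 (λ q t → q :* t :+ q :* t := (q :+ (q :+ con 0ℚ)) :* t)
        refl q (t k n) ⟩
      (q ℚ.+ (q ℚ.+ 0ℚ)) ℚ.* t k n ≡⟨ cong (ℚ._* t k n)
        (sym (trans (ιℕ-+ (Q (suc k)) (Q (suc k) ℕ.+ 0)) (cong (q ℚ.+_) (ιℕ-+ (Q (suc k)) 0)))) ⟩
      2q ℚ.* t k n ≤⟨ *-monoʳ-≤ (0≤ιℕ (2 ℕ.* Q (suc k))) t≤ ⟩
      2q ℚ.* (ι u ℚ.* t k n ℚ.+ ι v) ≡⟨ cong (2q ℚ.*_) (sym eq) ⟩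
      2q ℚ.* (y ℚ.* d k n) ≡⟨ sym (ℚ.*-assoc 2q y (d k n)) ⟩
      2q ℚ.* y ℚ.* d k n ∎)
      where
      open ℚ.≤-Reasoning
      q = ιℕ (Q (suc k))
      2q = ιℕ (2 ℕ.* Q (suc k))
      t≤ : t k n ℚ.≤ ι u ℚ.* t k n ℚ.+ ι v
      t≤ = subst (ℚ._≤ ι u ℚ.* t k n ℚ.+ ι v)
        (trans (ℚ.+-identityʳ (1ℚ ℚ.* t k n)) (ℚ.*-identityˡ (t k n)))
        (ℚ.+-mono-≤ (*-monoˡ-≤ (ℚ.<⇒≤ (0<t k n)) (ι-mono-≤ {+ 1} {u} 1≤u)) (ι-mono-≤ {+ 0} {v} 0≤v))

  best-approximation : ∀ k n p q → 0 ℕ.< q → q ℕ.< Q (suc k) →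
    1ℚ ℚ.≤ ιℕ (2 ℕ.* Q (suc k)) ℚ.* (ιℕ q ℚ.* x k n ℚ.- ι p) ⊎
    1ℚ ℚ.≤ ιℕ (2 ℕ.* Q (suc k)) ℚ.* (ι p ℚ.- ιℕ q ℚ.* x k n)
  best-approximation k n p q 0<q q<Q with signs-agree (Q k) (Q (suc k)) q
    (+ q ℤ.* P (suc k) ℤ.- p ℤ.* + Q (suc k)) (+ q ℤ.* P k ℤ.- p ℤ.* + Q k) 0<q q<Q ∣∣≡q
    where
    ∣∣≡q : ℤ.∣ + Q k ℤ.* (+ q ℤ.* P (suc k) ℤ.- p ℤ.* + Q (suc k)) ℤ.- + Q (suc k) ℤ.*
      (+ q ℤ.* P k ℤ.- p ℤ.* + Q k) ∣ ≡ q
    ∣∣≡q = trans (cong ℤ.∣_∣ (ℤS.solve 6 (λ q p P₁ P₀ Q₁ Q₀ → Q₀ ℤS.:* (q ℤS.:* P₁ ℤS.:- p ℤS.:* Q₁)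
      ℤS.:- Q₁ ℤS.:* (q ℤS.:* P₀ ℤS.:- p ℤS.:* Q₀) ℤS.:=
        q ℤS.:* (P₁ ℤS.:* Q₀ ℤS.:- P₀ ℤS.:* Q₁)) refl (+ q) p (P (suc k)) (P k) (+ Q (suc k)) (+ Q k)))
      (trans (ℤ.abs-* (+ q) _) (trans (cong (q ℕ.*_) (determinant k)) (ℕ.*-identityʳ q)))
  ... | inj₁ (1≤u , 0≤v) = inj₁ (error-≥ k n (ιℕ q ℚ.* x k n ℚ.- ι p) _ _ 1≤u 0≤v (error k n p q))
  ... | inj₂ (1≤u , 0≤v) = inj₂ (error-≥ k n (ι p ℚ.- ιℕ q ℚ.* x k n) _ _ 1≤u 0≤v (begin
    (ι p ℚ.- ιℕ q ℚ.* x k n) ℚ.* d k n ≡⟨ solve 3 (λ p y d → (p :- y) :* d := :- ((y :- p) :* d)) refl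
      (ι p) (ιℕ q ℚ.* x k n) (d k n) ⟩
    ℚ.- ((ιℕ q ℚ.* x k n ℚ.- ι p) ℚ.* d k n) ≡⟨ cong ℚ.-_ (error k n p q) ⟩
    ℚ.- (ι u ℚ.* t k n ℚ.+ ι v) ≡⟨ solve 3 (λ u t v → :- (u :* t :+ v) := (:- u) :* t :+ (:- v)) refl
      (ι u) (t k n) (ι v) ⟩
    (ℚ.- ι u) ℚ.* t k n ℚ.+ (ℚ.- ι v) ≡⟨ cong₂ (λ y z → y ℚ.* t k n ℚ.+ z) (sym (ι-neg u))
      (sym (ι-neg v)) ⟩
    ι (ℤ.- u) ℚ.* t k n ℚ.+ ι (ℤ.- v) ∎))
    where
    open ≡-Reasoning
    u = + q ℤ.* P (suc k) ℤ.- p ℤ.* + Q (suc k)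
    v = + q ℤ.* P k ℤ.- p ℤ.* + Q k

  private
    error-≤ : ∀ k n y w → w ℤ.≤ + 1 → y ℚ.* d k n ≡ ι w → ιℕ (Q (suc k)) ℚ.* y ℚ.≤ 1ℚ
    error-≤ k n y w w≤1 eq = *-cancelʳ-≤ (0<d k n) (begin
      q ℚ.* y ℚ.* d k n ≡⟨ ℚ.*-assoc q y (d k n) ⟩
      q ℚ.* (y ℚ.* d k n) ≡⟨ cong (q ℚ.*_) eq ⟩
      q ℚ.* ι w ≤⟨ *-monoʳ-≤ (0≤ιℕ (Q (suc k))) (ι-mono-≤ {w} {+ 1} w≤1) ⟩
      q ℚ.* 1ℚ ≡⟨ ℚ.*-identityʳ q ⟩
      q ≤⟨ Q≤d k n ⟩
      d k n ≡⟨ sym (ℚ.*-identityˡ (d k n)) ⟩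
      1ℚ ℚ.* d k n ∎)
      where
      open ℚ.≤-Reasoning
      q = ιℕ (Q (suc k))

    i≤∣i∣ : ∀ i → i ℤ.≤ + ℤ.∣ i ∣
    i≤∣i∣ (+ n)    = ℤ.≤-refl
    i≤∣i∣ -[1+ n ] = ℤ.-≤+

  -- For p / q = pₖ / qₖ the coefficient u vanishes and v = ±1 by the determinant, so ∣q x - p∣ is
  -- the reciprocal of qₖ t + qₖ₋₁ ≥ qₖ.
  convergents-approximate : ∀ k n →
    ιℕ (Q (suc k)) ℚ.* (ιℕ (Q (suc k)) ℚ.* x k n ℚ.- ι (P (suc k))) ℚ.≤ 1ℚ ×
    ιℕ (Q (suc k)) ℚ.* (ι (P (suc k)) ℚ.- ιℕ (Q (suc k)) ℚ.* x k n) ℚ.≤ 1ℚ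
  convergents-approximate k n =
    error-≤ k n _ w (subst (λ z → w ℤ.≤ + z) ∣w∣≡1 (i≤∣i∣ w)) eq ,
    error-≤ k n _ (ℤ.- w) (subst (λ z → ℤ.- w ℤ.≤ + z) (trans (ℤ.∣-i∣≡∣i∣ w) ∣w∣≡1) (i≤∣i∣ (ℤ.- w)))
      (trans (solve 3 (λ p y d → (p :- y) :* d := :- ((y :- p) :* d)) refl (ι (P (suc k)))
        (ιℕ (Q (suc k)) ℚ.* x k n) (d k n))
        (trans (cong ℚ.-_ eq) (sym (ι-neg w))))
    where
    w = + Q (suc k) ℤ.* P k ℤ.- P (suc k) ℤ.* + Q k
    ∣w∣≡1 : ℤ.∣ w ∣ ≡ 1
    ∣w∣≡1 = trans (cong ℤ.∣_∣ {w} {ℤ.- (P (suc k) ℤ.* + Q k ℤ.- P k ℤ.* + Q (suc k))}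
      (ℤS.solve 4 (λ P₁ P₀ Q₁ Q₀ → Q₁ ℤS.:* P₀ ℤS.:- P₁ ℤS.:* Q₀ ℤS.:=
        ℤS.:- (P₁ ℤS.:* Q₀ ℤS.:- P₀ ℤS.:* Q₁)) refl (P (suc k)) (P k) (+ Q (suc k)) (+ Q k)))
      (trans (ℤ.∣-i∣≡∣i∣ (P (suc k) ℤ.* + Q k ℤ.- P k ℤ.* + Q (suc k))) (determinant k))
    eq : (ιℕ (Q (suc k)) ℚ.* x k n ℚ.- ι (P (suc k))) ℚ.* d k n ≡ ι w
    eq = begin
      (ιℕ (Q (suc k)) ℚ.* x k n ℚ.- ι (P (suc k))) ℚ.* d k n ≡⟨ error k n (P (suc k)) (Q (suc k)) ⟩
      ι (+ Q (suc k) ℤ.* P (suc k) ℤ.- P (suc k) ℤ.* + Q (suc k)) ℚ.* t k n ℚ.+ ι w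
        ≡⟨ cong (λ z → ι z ℚ.* t k n ℚ.+ ι w)
          (ℤS.solve 2 (λ p q → q ℤS.:* p ℤS.:- p ℤS.:* q ℤS.:= ℤS.con (+ 0)) refl (P (suc k))
          (+ Q (suc k))) ⟩
      0ℚ ℚ.* t k n ℚ.+ ι w ≡⟨ trans (cong (ℚ._+ ι w) (ℚ.*-zeroˡ (t k n))) (ℚ.+-identityˡ (ι w)) ⟩
      ι w ∎
      where open ≡-Reasoning

-- Distance from α to rational numbers

crossing : ∀ (f : ℕ → ℕ) q N d → f N ℕ.≤ q → q ℕ.< f (d ℕ.+ N) →
  ∃[ n ] N ℕ.≤ n × f n ℕ.≤ q × q ℕ.< f (suc n)
crossing f q N zero    fN≤q q<f = contradiction q<f (ℕ.≤⇒≯ fN≤q)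
crossing f q N (suc d) fN≤q q<f with f (d ℕ.+ N) ℕ.≤? q
... | yes f≤q = d ℕ.+ N , ℕ.m≤n+m N d , f≤q , q<f
... | no  f≰q = crossing f q N d fN≤q (ℕ.≰⇒> f≰q)

-- z ≥ 1/c ≥ 2/M = 2s. The weaker bound 3s/2 is strict and leaves s/2 for the distance between α and
-- a convergent.
doubled-gap : ∀ c M s z → c ℕ.+ c ℕ.≤ M → 0ℚ ℚ.≤ s → s ℚ.* ιℕ M ≡ 1ℚ → 1ℚ ℚ.≤ ιℕ c ℚ.* z →
  s ℚ.+ s ℚ.* ½ ℚ.< z
doubled-gap c M s z 2c≤M 0≤s sM≡1 1≤cz = ℚ.≰⇒> λ z≤ → ≤⇒≯ (begin
  1ℚ                              ≤⟨ 1≤cz ⟩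
  ιℕ c ℚ.* z                      ≤⟨ *-monoʳ-≤ (0≤ιℕ c) z≤ ⟩
  ιℕ c ℚ.* (s ℚ.+ s ℚ.* ½)        ≡⟨ solve 2 (λ c s → c :* (s :+ s :* con ½) := s :* (c :+ c) :* con
    (½ ℚ.+ ½ ℚ.* ½)) refl (ιℕ c) s ⟩
  s ℚ.* (ιℕ c ℚ.+ ιℕ c) ℚ.* ¾     ≡⟨ cong (λ z → s ℚ.* z ℚ.* ¾) (sym (ιℕ-+ c c)) ⟩
  s ℚ.* ιℕ (c ℕ.+ c) ℚ.* ¾        ≤⟨ *-monoˡ-≤ {¾} (ℚ.nonNegative⁻¹ ¾)
    (*-monoʳ-≤ 0≤s (ιℕ-mono-≤ {c ℕ.+ c} {M} 2c≤M)) ⟩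
  s ℚ.* ιℕ M ℚ.* ¾                ≡⟨ cong (ℚ._* ¾) sM≡1 ⟩
  ¾                               ∎) (ℚ.*<* (ℤ.+<+ (ℕ.s≤s (ℕ.s≤s (ℕ.s≤s (ℕ.s≤s ℕ.z≤n))))))
  where
  open ℚ.≤-Reasoning
  ¾ = ½ ℚ.+ ½ ℚ.* ½

-- The triangle inequality for ∣α - x∣ < δ: an endpoint x ± δ is the rational taken from α, and the
-- other summand is then forced.
distance-lower : ∀ {α} ρ {x δ s} → lower α (x ℚ.- δ) → upper α (x ℚ.+ δ) →
  s ℚ.+ δ ℚ.< x ℚ.- ρ ⊎ s ℚ.+ δ ℚ.< ρ ℚ.- x → lower ∣ α - fromℚ ρ ∣ s
distance-lower ρ {x} {δ} {s} l u (inj₁ lt) = inj₁ (x ℚ.- δ , s ℚ.- (x ℚ.- δ) , l ,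
  0<-⇒< (subst (0ℚ ℚ.<_) (solve 4 (λ s d x r → (x :- r) :- (s :+ d) := :- (s :- (x :- d)) :- r) refl s δ
    x ρ) (<⇒0<- lt)) ,
  solve 3 (λ s d x → (x :- d) :+ (s :- (x :- d)) := s) refl s δ x)
distance-lower ρ {x} {δ} {s} l u (inj₂ lt) = inj₂ (x ℚ.+ δ , ℚ.- s ℚ.- (x ℚ.+ δ) , u ,
  0<-⇒< (subst (0ℚ ℚ.<_) (solve 4 (λ s d x r → (r :- x) :- (s :+ d) := r :- :- (:- s :- (x :+ d))) refl
    s δ x ρ) (<⇒0<- lt)) ,
  solve 3 (λ s d x → (x :+ d) :+ (:- s :- (x :+ d)) := :- s) refl s δ x)

distance-lower⁻¹ : ∀ {α} ρ {x δ s} → IsReal α → lower α (x ℚ.- δ) → upper α (x ℚ.+ δ) →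
  lower ∣ α - fromℚ ρ ∣ s →
  s ℚ.- δ ℚ.< x ℚ.- ρ ⊎ s ℚ.- δ ℚ.< ρ ℚ.- x
distance-lower⁻¹ ρ {x} {δ} {s} αR l u (inj₁ (s₁ , t₁ , ls , ρ<-t , refl)) = inj₁ (0<-⇒< (subst (0ℚ ℚ.<_)
  (solve 5 (λ s t d x r → ((x :+ d) :- s) :+ (:- t :- r) := (x :- r) :- ((s :+ t) :- d)) refl s₁ t₁ δ x
    ρ)
  (ℚ.+-mono-< (<⇒0<- (lower<upper αR ls u)) (<⇒0<- ρ<-t))))
distance-lower⁻¹ ρ {x} {δ} {s} αR l u (inj₂ (s₁ , t₁ , us , -t<ρ , eq)) = inj₂ (0<-⇒< (subst (0ℚ ℚ.<_)
  (trans (solve 5 (λ s t d x r → (s :- (x :- d)) :+ (r :- :- t) := (r :- x) :- (:- (s :+ t) :- d)) refl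
    s₁ t₁ δ x ρ)
    (cong (λ z → (ρ ℚ.- x) ℚ.- (z ℚ.- δ)) (trans (cong ℚ.-_ eq)
      (solve 1 (λ s → :- (:- s) := s) refl s))))
  (ℚ.+-mono-< (<⇒0<- (lower<upper αR l us)) (<⇒0<- -t<ρ))))

module Approximation (α : Cut) (αR : IsReal α) (b : ℕ → ℤ) (b-pos : ∀ n → ℤ.Positive (b (suc n)))
  (α=[b] : IsContinuedFractionOf b b-pos α) where

  open ContinuedFraction b b-pos

  near-convergent : ∀ k δ → 0ℚ ℚ.< δ → ∃[ n ] lower α (convergent b b-pos (k ℕ.+ suc n) ℚ.- δ) ×
    upper α (convergent b b-pos (k ℕ.+ suc n) ℚ.+ δ)
  near-convergent k δ 0<δ with α=[b] (fromℚ δ) (fromℚ-isReal δ) (ℚ.<-dense 0<δ)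
  ... | N , close with close (k ℕ.+ suc N) (ℕ.≤-trans (ℕ.n≤1+n N) (ℕ.m≤n+m (suc N) k))
  ... | r , ((s , t , x<s , l , s+t≡r) , (s′ , t′ , s′<x , u , s′+t′≡-r)) , r<δ = N ,
    IsReal.lower-closed αR (0<-⇒< (subst (0ℚ ℚ.<_)
      (solve 4 (λ s t x d → (s :- x) :+ (d :- (s :+ t)) := :- t :- (x :- d)) refl s t x δ)
      (ℚ.+-mono-< (<⇒0<- x<s) (<⇒0<- (subst (ℚ._< δ) (sym s+t≡r) r<δ))))) l ,
    IsReal.upper-closed αR (0<-⇒< (subst (0ℚ ℚ.<_)
      (solve 4 (λ s t x d → (x :- s) :+ (d :- :- (s :+ t)) := (x :+ d) :- :- t) refl s′ t′ x δ)
      (ℚ.+-mono-< (<⇒0<- s′<x) (<⇒0<- (subst (ℚ._< δ)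
        (trans (solve 1 (λ r → r := :- (:- r)) refl r) (cong ℚ.-_ (sym s′+t′≡-r))) r<δ))))) u
    where x = convergent b b-pos (k ℕ.+ suc N)

  -- All that the two bounds need from continued fractions: n is late enough for the growth
  -- hypothesis, Fₙ ≤ q measures n by q, and `B n` is bₙ₊₁. Ranging over all M leaves the proof that
  -- the denominator is nonzero to the place of use.
  Separated : ℕ → ℤ → (q : ℕ) .{{_ : ℕ.NonZero q}} → Set
  Separated N p q = ∃[ n ] N ℕ.≤ n × fib n ℕ.≤ q ×
    (∀ M .{{_ : ℕ.NonZero M}} → 8 ℕ.* (B n ℕ.* (q ℕ.* q)) ℕ.≤ M →
      lower ∣ α - fromℚ (p ℚ./ q) ∣ (+ 1 ℚ./ M))

  separation : ∀ N (p : ℤ) q .{{_ : ℕ.NonZero q}} → Q (suc N) ℕ.≤ q → Separated N p q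
  -- Going q + 1 steps past N is enough, because qₘ ≥ Fₘ ≥ m.
  separation N p q Q≤q with crossing (λ n → Q (suc n)) q N (suc q) Q≤q
    (ℕ.≤-trans (ℕ.m≤m+n (suc q) N) (ℕ.≤-trans (n≤fib (suc q ℕ.+ N)) (fib≤Q (suc q ℕ.+ N))))
  ... | n , N≤n , Qn≤q , q<Q = n , N≤n , ℕ.≤-trans (fib≤Q n) Qn≤q , far
    where
    far : ∀ M .{{_ : ℕ.NonZero M}} → 8 ℕ.* (B n ℕ.* (q ℕ.* q)) ℕ.≤ M →
      lower ∣ α - fromℚ (p ℚ./ q) ∣ (+ 1 ℚ./ M)
    far M ≤M = conclude (near-convergent (suc n) (s ℚ.* ½) (0<* (0<1/ M) (ℚ.positive⁻¹ ½)))
      where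
      x : ℕ → ℚ
      x m = convergent b b-pos (suc n ℕ.+ suc m)
      ρ = p ℚ./ q
      2Q = 2 ℕ.* Q (suc (suc n))
      s = + 1 ℚ./ M
      2Qq≤ : 2Q ℕ.* q ℕ.+ 2Q ℕ.* q ℕ.≤ M
      2Qq≤ = begin
        2Q ℕ.* q ℕ.+ 2Q ℕ.* q ≡⟨ ℕS.solve 2 (λ Q q → ℕS.con 2 ℕS.:* Q ℕS.:* q ℕS.:+ ℕS.con 2 ℕS.:* Q
          ℕS.:* q ℕS.:= ℕS.con 4 ℕS.:* (q ℕS.:* Q)) refl (Q (suc (suc n))) q ⟩
        4 ℕ.* (q ℕ.* Q (suc (suc n))) ≤⟨ ℕ.*-monoʳ-≤ 4
          (ℕ.*-monoʳ-≤ q (ℕ.≤-trans (Q≤2BQ n) (ℕ.*-monoʳ-≤ 2 (ℕ.*-monoʳ-≤ (B n) Qn≤q)))) ⟩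
        4 ℕ.* (q ℕ.* (2 ℕ.* (B n ℕ.* q))) ≡⟨ ℕS.solve 2
          (λ B q → ℕS.con 4 ℕS.:* (q ℕS.:* (ℕS.con 2 ℕS.:* (B ℕS.:* q))) ℕS.:= ℕS.con 8 ℕS.:*
          (B ℕS.:* (q ℕS.:* q))) refl (B n) q ⟩
        8 ℕ.* (B n ℕ.* (q ℕ.* q)) ≤⟨ ≤M ⟩
        M ∎
        where open ℕ.≤-Reasoning
      widen : ∀ z → 1ℚ ℚ.≤ ιℕ 2Q ℚ.* (ιℕ q ℚ.* z) → s ℚ.+ s ℚ.* ½ ℚ.< z
      widen z 1≤ = doubled-gap (2Q ℕ.* q) M s z 2Qq≤ (ℚ.<⇒≤ (0<1/ M)) (/-*-cancel (+ 1) M)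
        (subst (1ℚ ℚ.≤_) (trans (sym (ℚ.*-assoc (ιℕ 2Q) (ιℕ q) z)) (cong (ℚ._* z) (sym (ιℕ-* 2Q q))))
          1≤)
      ιp≡ : ι p ≡ ιℕ q ℚ.* ρ
      ιp≡ = trans (sym (/-*-cancel p q)) (ℚ.*-comm ρ (ιℕ q))
      gap : ∀ x → 1ℚ ℚ.≤ ιℕ 2Q ℚ.* (ιℕ q ℚ.* x ℚ.- ι p) ⊎ 1ℚ ℚ.≤ ιℕ 2Q ℚ.* (ι p ℚ.- ιℕ q ℚ.* x) →
        s ℚ.+ s ℚ.* ½ ℚ.< x ℚ.- ρ ⊎ s ℚ.+ s ℚ.* ½ ℚ.< ρ ℚ.- x
      gap x (inj₁ h) = inj₁ (widen (x ℚ.- ρ) (subst (λ z → 1ℚ ℚ.≤ ιℕ 2Q ℚ.* z)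
        (trans (cong (λ z → ιℕ q ℚ.* x ℚ.- z) ιp≡)
          (solve 3 (λ q x r → q :* x :- q :* r := q :* (x :- r)) refl (ιℕ q) x ρ)) h))
      gap x (inj₂ h) = inj₂ (widen (ρ ℚ.- x) (subst (λ z → 1ℚ ℚ.≤ ιℕ 2Q ℚ.* z)
        (trans (cong (λ z → z ℚ.- ιℕ q ℚ.* x) ιp≡)
          (solve 3 (λ q x r → q :* r :- q :* x := q :* (r :- x)) refl (ιℕ q) x ρ)) h))
      conclude : (∃[ m ] lower α (x m ℚ.- s ℚ.* ½) × upper α (x m ℚ.+ s ℚ.* ½)) →
        lower ∣ α - fromℚ ρ ∣ s
      conclude (m , l , u) = distance-lower {α} ρ {x m} {s ℚ.* ½} {s} l u
        (gap (x m) (best-approximation (suc n) m p q (ℕ.n≢0⇒n>0 (ℕ.≢-nonZero⁻¹ q)) q<Q))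

  convergent-near : ∀ k s .{{_ : ℕ.NonZero (Q (suc k))}} → 1ℚ ℚ.< s ℚ.* ιℕ (Q (suc k) ℕ.* Q (suc k)) →
    ¬ lower ∣ α - fromℚ (P (suc k) ℚ./ Q (suc k)) ∣ s
  -- The tolerance is the whole slack s - 1/qₖ²: if s were below ∣α - pₖ/qₖ∣, a convergent this
  -- close to α would be farther than 1/qₖ² from pₖ/qₖ.
  convergent-near k s 1<sqq low = conclude (near-convergent k (s ℚ.- i)
    (<⇒0<- (1<x*n⇒1/n<x {q ℕ.* q} {s} 1<sqq)))
    where
    q = Q (suc k)
    instance
      qq≢0 : ℕ.NonZero (q ℕ.* q)
      qq≢0 = ℕ.m*n≢0 q q
    i = + 1 ℚ./ (q ℕ.* q)
    ρ = P (suc k) ℚ./ q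
    x : ℕ → ℚ
    x n = convergent b b-pos (k ℕ.+ suc n)
    ιp≡ : ι (P (suc k)) ≡ ιℕ q ℚ.* ρ
    ιp≡ = trans (sym (/-*-cancel (P (suc k)) q)) (ℚ.*-comm ρ (ιℕ q))
    too-far : ∀ z {y} → y ℚ.≤ 1ℚ → y ≡ ιℕ q ℚ.* ιℕ q ℚ.* z → ¬ (s ℚ.- (s ℚ.- i) ℚ.< z)
    too-far z {y} y≤1 y≡ lt = ≤⇒≯ y≤1 (subst₂ ℚ._<_
      (trans (cong (ιℕ (q ℕ.* q) ℚ.*_) (solve 2 (λ s i → s :- (s :- i) := i) refl s i))
        (trans (ℚ.*-comm (ιℕ (q ℕ.* q)) i) (/-*-cancel (+ 1) (q ℕ.* q))))
      (trans (cong (ℚ._* z) (ιℕ-* q q)) (sym y≡))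
      (*-monoʳ-< (ιℕ-mono-< {0} {q ℕ.* q} (ℕ.n≢0⇒n>0 (ℕ.≢-nonZero⁻¹ (q ℕ.* q)))) lt))
    near : ∀ x →
      ιℕ q ℚ.* (ιℕ q ℚ.* x ℚ.- ι (P (suc k))) ℚ.≤ 1ℚ × ιℕ q ℚ.* (ι (P (suc k)) ℚ.- ιℕ q ℚ.* x) ℚ.≤ 1ℚ →
      ¬ (s ℚ.- (s ℚ.- i) ℚ.< x ℚ.- ρ ⊎ s ℚ.- (s ℚ.- i) ℚ.< ρ ℚ.- x)
    near x (≤1 , _) (inj₁ h) = too-far (x ℚ.- ρ) ≤1
      (trans (cong (λ z → ιℕ q ℚ.* (ιℕ q ℚ.* x ℚ.- z)) ιp≡)
      (solve 3 (λ q x r → q :* (q :* x :- q :* r) := (q :* q) :* (x :- r)) refl (ιℕ q) x ρ)) h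
    near x (_ , ≤1) (inj₂ h) = too-far (ρ ℚ.- x) ≤1
      (trans (cong (λ z → ιℕ q ℚ.* (z ℚ.- ιℕ q ℚ.* x)) ιp≡)
      (solve 3 (λ q x r → q :* (q :* r :- q :* x) := (q :* q) :* (r :- x)) refl (ιℕ q) x ρ)) h
    conclude : ¬ (∃[ n ] lower α (x n ℚ.- (s ℚ.- i)) × upper α (x n ℚ.+ (s ℚ.- i)))
    conclude (n , l , u) = near (x n) (convergents-approximate k n)
      (distance-lower⁻¹ ρ {x n} {s ℚ.- i} {s} αR l u low)

-- The exponent and the base

module Corollary (α : Cut) (αR : IsReal α) (b : ℕ → ℤ) (b-pos : ∀ n → ℤ.Positive (b (suc n)))
  (α=[b] : IsContinuedFractionOf b b-pos α) where

  open ContinuedFraction b b-pos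
  open Approximation α αR b b-pos α=[b]

  growth : ∀ g → b =e^o g → ∀ K .{{_ : ℕ.NonZero K}} →
    ∃[ N ] (∀ n → N ℕ.≤ n → B n ℕ.^ K ℕ.< 3 ℕ.^ g (suc n))
  growth g b=e^og K =
    let (N , h) = b=e^og (fromℚ (+ 1 ℚ./ K)) (fromℚ-isReal _) (ℚ.<-dense (0<1/ K))
    in N , λ n N≤n → ln÷-bound (B n) (g (suc n)) K (b≡B n) (1≤B n) (h n N≤n)

  M≢0 : ∀ n q .{{_ : ℕ.NonZero q}} → ℕ.NonZero (8 ℕ.* (B n ℕ.* (q ℕ.* q)))
  M≢0 n q = ℕ.m*n≢0 8 (B n ℕ.* (q ℕ.* q)) {{_}}
    {{ℕ.m*n≢0 (B n) (q ℕ.* q) {{ℕ.>-nonZero (1≤B n)}} {{ℕ.m*n≢0 q q}}}}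

  exponentBound : b =e^o (λ n → n) → ExponentBound α (fromℕ 2)
  exponentBound b=e^on = (1ℚ , 0<1 , ιℕ-mono-< {1} {2} ℕ.≤-refl) , bound
    where
    Bound : Cut → Set
    Bound ε = ∃[ Q₀ ] 1 ℕ.≤ Q₀ × (∀ (p : ℤ) (q : ℕ) .{{_ : ℕ.NonZero q}} → Q₀ ℕ.≤ q →
      fromℕ q ^ (- (fromℕ 2 + ε)) < ∣ α - fromℚ (p ℚ./ q) ∣)
    thresholds : ∀ {ε r} k .{{_ : ℕ.NonZero k}} T → IsReal ε → lower ε r → + 1 ℚ./ k ℚ.< r →
      (∀ B n q → B ℕ.^ (k ℕ.* 8) ℕ.< 3 ℕ.^ suc n → fib n ℕ.≤ q → 2 ℕ.≤ q → T ℕ.≤ q →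
        (8 ℕ.* (B ℕ.* (q ℕ.* q))) ℕ.^ k ℕ.< (q ℕ.∸ 1) ℕ.^ (2 ℕ.* k ℕ.+ 1)) →
      (∃[ N ] (∀ n → N ℕ.≤ n → B n ℕ.^ (k ℕ.* 8) ℕ.< 3 ℕ.^ suc n)) → Bound ε
    thresholds {ε} k {{k≢0}} T εR r<ε 1/k<r estimate (N , small) =
      2 ℕ.+ (T ℕ.+ Q (suc N)) , ℕ.s≤s ℕ.z≤n , λ p q Q₀≤q →
      let 2≤q = ℕ.m+n≤o⇒m≤o 2 Q₀≤q
          T+Q≤q = ℕ.m+n≤o⇒n≤o 2 Q₀≤q
      in far-enough p q 2≤q (ℕ.m+n≤o⇒m≤o T T+Q≤q) (separation N p q (ℕ.m+n≤o⇒n≤o T T+Q≤q))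
      where
      far-enough : ∀ p q .{{_ : ℕ.NonZero q}} → 2 ℕ.≤ q → T ℕ.≤ q → Separated N p q →
        fromℕ q ^ (- (fromℕ 2 + ε)) < ∣ α - fromℚ (p ℚ./ q) ∣
      far-enough p q 2≤q T≤q (n , N≤n , fib≤q , far) = (+ 1 ℚ./ M) {{M≢0 n q}} ,
        upper-power k M q {{k≢0}} {{M≢0 n q}} εR r<ε 1/k<r 2≤q
          (estimate (B n) n q (small n N≤n) fib≤q 2≤q T≤q) , far M {{M≢0 n q}} ℕ.≤-refl
        where M = 8 ℕ.* (B n ℕ.* (q ℕ.* q))
    bound : ∀ ε → IsReal ε → fromℕ 0 < ε → Bound ε
    bound ε εR (r , 0<r , r<ε) =
      let (k , 1<rk) = archimedean r 0<r
      in thresholds (suc k) ((2 ℕ.^ (5 ℕ.* suc k ℕ.+ 1)) ℕ.^ 8 ℕ.* 16) εR r<ε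
        (1<x*n⇒1/n<x {suc k} {r} 1<rk)
        -- The power 8 (k + 1) makes B^(k + 1) at most a constant times the square root of q; the
        -- other half power of q absorbs the constants.
        (exponent-estimate (suc k)) (growth (λ n → n) b=e^on (suc k ℕ.* 8))

  exponent≥2 : ∀ y → IsReal y → ExponentBound α y → fromℕ 2 ≤ y
  exponent≥2 y yR (_ , bound) (ρ , y<ρ , ρ<2) = conclude
    (bound (fromℚ (ιℕ 2 ℚ.- ρ)) (fromℚ-isReal _) (ℚ.<-dense (<⇒0<- {ρ} {ιℕ 2} ρ<2)))
    where
    conclude : ¬ (∃[ Q₀ ] 1 ℕ.≤ Q₀ × (∀ (p : ℤ) (q : ℕ) .{{_ : ℕ.NonZero q}} → Q₀ ℕ.≤ q →
      fromℕ q ^ (- (y + fromℚ (ιℕ 2 ℚ.- ρ))) < ∣ α - fromℚ (p ℚ./ q) ∣))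
    conclude (Q₀ , _ , h) =
      -- A single convergent refutes the bound; index Q₀ is far enough, since its denominator is at
      -- least F at Q₀, hence at least Q₀.
      let (s , q^<s , s<) = h (P (suc Q₀)) (Q (suc Q₀)) {{ℕ.>-nonZero (1≤Q Q₀)}}
            (ℕ.≤-trans (n≤fib Q₀) (fib≤Q Q₀))
      in convergent-near Q₀ s {{ℕ.>-nonZero (1≤Q Q₀)}}
           (upper-power⁻¹ {y} {ρ} {s} (Q (suc Q₀)) yR y<ρ (1≤Q Q₀) q^<s) s<

  baseBound : b =e^o fib → BaseBound α (fromℕ 1)
  baseBound b=e^ofib = (λ (r , 1<r , r<1) → ℚ.<-asym 1<r r<1) , bound
    where
    Bound : Cut → Set
    Bound ε = ∃[ Q₀ ] 1 ℕ.≤ Q₀ × (∀ (p : ℤ) (q : ℕ) .{{_ : ℕ.NonZero q}} → Q₀ ℕ.≤ q →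
      recip ((fromℕ 1 + ε) ^ fromℕ q) < ∣ α - fromℚ (p ℚ./ q) ∣)
    thresholds : ∀ {ε r} k .{{_ : ℕ.NonZero k}} T → IsReal ε → lower ε r → + 1 ℚ./ k ℚ.< r →
      (∀ B n q → B ℕ.^ (2 ℕ.* (4 ℕ.* suc k)) ℕ.< 3 ℕ.^ fib (suc n) → fib n ℕ.≤ q → 2 ℕ.≤ q → T ℕ.≤ q →
        8 ℕ.* (B ℕ.* (q ℕ.* q)) ℕ.< 2 ℕ.^ ((q ℕ.∸ 2) ℕ./ k)) →
      (∃[ N ] (∀ n → N ℕ.≤ n → B n ℕ.^ (2 ℕ.* (4 ℕ.* suc k)) ℕ.< 3 ℕ.^ fib (suc n))) → Bound ε
    thresholds {ε} k {{k≢0}} T εR r<ε 1/k<r estimate (N , small) =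
      2 ℕ.+ (T ℕ.+ Q (suc N)) , ℕ.s≤s ℕ.z≤n , λ p q Q₀≤q →
      let 2≤q = ℕ.m+n≤o⇒m≤o 2 Q₀≤q
          T+Q≤q = ℕ.m+n≤o⇒n≤o 2 Q₀≤q
      in far-enough p q 2≤q (ℕ.m+n≤o⇒m≤o T T+Q≤q) (separation N p q (ℕ.m+n≤o⇒n≤o T T+Q≤q))
      where
      far-enough : ∀ p q .{{_ : ℕ.NonZero q}} → 2 ℕ.≤ q → T ℕ.≤ q → Separated N p q →
        recip ((fromℕ 1 + ε) ^ fromℕ q) < ∣ α - fromℚ (p ℚ./ q) ∣
      far-enough p q 2≤q T≤q (n , N≤n , fib≤q , far) = (+ 1 ℚ./ M) {{M≢0 n q}} ,
        upper-recip-power k i M q {{k≢0}} {{M≢0 n q}} εR r<ε 1/k<r (ℕ.≤-trans (ℕ.n≤1+n 1) 2≤q) ki<q-1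
          (estimate (B n) n q (small n N≤n) fib≤q 2≤q T≤q) , far M {{M≢0 n q}} ℕ.≤-refl
        where
        M = 8 ℕ.* (B n ℕ.* (q ℕ.* q))
        -- Dividing q - 2 keeps k i strictly below q - 1, the smaller exponent of the box around q.
        i = (q ℕ.∸ 2) ℕ./ k
        ki<q-1 : k ℕ.* i ℕ.< q ℕ.∸ 1
        ki<q-1 = ℕ.≤-<-trans (ℕ.≤-trans (ℕ.≤-reflexive (ℕ.*-comm k i)) (ℕ.m/n*n≤m (q ℕ.∸ 2) k))
          (ℕ.≤-reflexive (sym (ℕ.+-∸-assoc 1 2≤q)))
    bound : ∀ ε → IsReal ε → fromℕ 0 < ε → Bound ε
    bound ε εR (r , 0<r , r<ε) =
      let (k , 1<rk) = archimedean r 0<r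
      in thresholds (suc k) (5 ℕ.* suc (suc k) ℕ.* (128 ℕ.* (5 ℕ.* suc (suc k)) ℕ.^ 4)) εR r<ε
        (1<x*n⇒1/n<x {suc k} {r} 1<rk)
        (base-estimate (suc k)) (growth fib b=e^ofib (2 ℕ.* (4 ℕ.* suc (suc k))))

corollary3 : ∀ (α : Cut) → IsReal α → Irrational α →
    ∀ (b : ℕ → ℤ) (b-pos : ∀ n → Positive (b (suc n))) →
    IsContinuedFractionOf b b-pos α →
    (b =e^o (λ n → n) → IrrationalityExponent α (finite (fromℕ 2))) ×
    (b =e^o fib → IrrationalityBase α (finite (fromℕ 1)))
corollary3 α αR _ b b-pos α=[b] =
  (λ b=e^on → (fromℚ-isReal _ , exponentBound b=e^on) , exponent≥2) ,
  -- Minimality of 1 is immediate, since the constraint 1 ≤ β is the first component of `BaseBound`.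
  (λ b=e^ofib → (fromℚ-isReal _ , baseBound b=e^ofib) , λ _ _ → proj₁)
  where open Corollary α αR b b-pos α=[b]
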